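{- There exists no uniform encoding $[\![\cdot]\!]$ of the mixed-choice $\pi$-calculus $\pi_m$ into the separate-choice $\pi$-calculus $\pi_s$ preserving a reasonable semantics.
   Context: **Calculus.** Fix a countable set $\mathcal N$ of names $x,y,\ldots$. The mixed-choice $\pi$-calculus $\pi_m$ has prefixes $\alpha ::= x(y)\mid \bar x y\mid\tau$ (input, output, silent) and processes $P ::= \sum_i\alpha_i.P_i\mid \nu x\,P\mid P|P\mid\, !P$, with finite sums; $\mathbf 0$ is the empty sum. The separate-choice $\pi$-calculus $\pi_s$ is the subset of $\pi_m$ in which every sum is either of the form $\sum_i\alpha^I_i.P_i$ with each $\alpha^I_i$ of the form $x(y)$ or $\tau$, or of the form $\sum_i\alpha^O_i.P_i$ with each $\alpha^O_i$ of the form $\bar x y$ or $\tau$. The operators $\nu x$ and $y(x).$ bind $x$; $\mathrm{fn}(P)$ is the set of free names of $P$; $P\{y/x\}$ is capture-avoiding renaming. A special free channel name $\mathit{out}$ is used for communicating with the external world and is not used by processes to communicate with each other; a special subset of $\mathcal N$ is identified with the natural numbers, used as identifiers of processes and never used as bound names. **Semantics (shared by $\pi_m$ and $\pi_s$).** Actions are $\mu::= xy\mid\bar x y\mid\bar x(y)\mid\tau$ (input, free output, bound output, silent); $\mathrm{bn}(\bar x(y))=\{y\}$ and $\mathrm{bn}(\mu)=\emptyset$ otherwise; $\mathrm n(\mu)$ is the set of names occurring in $\mu$. $\equiv$ is the congruence generated by alpha-conversion and $(\nu x P)|Q\equiv\nu x(P|Q)$ if $x\notin\mathrm{fn}(Q)$.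 Transitions are generated by: (I-Sum) $\sum_i\alpha_i.P_i\xrightarrow{xy}P_j\{y/z\}$ if $\alpha_j=x(z)$; (O/$\tau$-Sum) $\sum_i\alpha_i.P_i\xrightarrow{\alpha_j}P_j$ if $\alpha_j$ is $\bar xy$ or $\tau$; (Open) if $P\xrightarrow{\bar xy}P'$ and $x\ne y$ then $\nu yP\xrightarrow{\bar x(y)}P'$; (Res) if $P\xrightarrow{\mu}P'$ and $y\notin \mathrm n(\mu)$ then $\nu yP\xrightarrow{\mu}\nu yP'$; (Par) if $P\xrightarrow{\mu}P'$ and $\mathrm{bn}(\mu)\cap\mathrm{fn}(Q)=\emptyset$ then $P|Q\xrightarrow{\mu}P'|Q$; (Com) if $P\xrightarrow{xy}P'$ and $Q\xrightarrow{\bar xy}Q'$ then $P|Q\xrightarrow{\tau}P'|Q'$; (Close) if $P\xrightarrow{xy}P'$, $Q\xrightarrow{\bar x(y)}Q'$ and $y\notin\mathrm{fn}(P)$ then $P|Q\xrightarrow{\tau}\nu y(P'|Q')$; (Rep) if $P\,|\,!P\xrightarrow{\mu}P'$ then $!P\xrightarrow{\mu}P'$; (Cong) if $P'\equiv P$, $P\xrightarrow{\mu}Q$, $Q\equiv Q'$ then $P'\xrightarrow{\mu}Q'$; together with the symmetric versions of Par, Com, Close. A computation is a finite or $\omega$-infinite sequence of consecutive transitions; it is maximal if it is infinite or cannot be extended. **Encodings.** An encoding is a map $[\![\cdot]\!]$ from processes of the source language to processes of the target language. It is uniform if (i) $[\![P\,|\,Q]\!]=[\![P]\!]\,|\,[\![Q]\!]$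 for all $P,Q$; and (ii) for any permutation of names $\sigma$ in the domain of the source language there exists a permutation of names $\theta$ in the domain of the target language such that $\sigma(i)=\theta(i)$ for every natural number (identifier) $i$ and $[\![\sigma(P)]\!]=\theta([\![P]\!])$, where applying a permutation to a process means renaming its free names accordingly (avoiding capture). **Reasonable semantics.** The observables of a computation are the actions performed on the channel $\mathit{out}$. A semantics (equivalence on processes) is reasonable if it distinguishes two processes $P$ and $Q$ whenever there exists a maximal (finite or infinite) computation of $P$ in which the observables are different from the observables in any maximal computation of $Q$. The encoding preserves the semantics if $P$ and $[\![P]\!]$ are not distinguished by it, for every source process $P$. -}

module Defs where

open import Data.Fin using (Fin; zero; suc)
open import Data.List using (List; []; _∷_; _++_)
open import Data.List.Membership.Propositional using (_∈_; _∉_)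
open import Data.List.Relation.Binary.Disjoint.Propositional using (Disjoint)
open import Data.List.Relation.Binary.Pointwise using (Pointwise)
open import Data.List.Relation.Unary.All using (All)
open import Data.Maybe using (Maybe; just; nothing)
open import Data.Nat using (ℕ; zero; suc)
import Data.Nat.Properties as ℕₚ
open import Data.Product using (Σ-syntax; ∃; _×_; _,_; proj₁)
open import Data.Sum using (_⊎_)
open import Data.Unit using (⊤)
open import Function.Bundles using (_↔_; _⇔_; Inverse)
open import Relation.Binary.Construct.Closure.ReflexiveTransitive using (Star; ε; _◅_)
open import Relation.Binary.Core using (Rel)
open import Relation.Binary.Definitions using (DecidableEquality)
open import Relation.Binary.PropositionalEquality using (_≡_; _≢_; refl; cong)
open import Relation.Nullary using (¬_; yes; no)
open import Relation.Nullary.Decidable using (map′)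

------------------------------------------------------------------------
-- Names

-- `ident i` is the natural number i, seen as the identifier of a process.
-- Only the ordinary names `chan k` ever serve as bound names: identifiers
-- and `out` are never bound.
data Name : Set where
  chan  : ℕ → Name
  ident : ℕ → Name
  out   : Name

infix 4 _≟_

_≟_ : DecidableEquality Name
chan k  ≟ chan l  = map′ (cong chan) (λ { refl → refl }) (k ℕₚ.≟ l)
chan _  ≟ ident _ = no λ ()
chan _  ≟ out     = no λ ()
ident _ ≟ chan _  = no λ ()
ident i ≟ ident j = map′ (cong ident) (λ { refl → refl }) (i ℕₚ.≟ j)
ident _ ≟ out     = no λ ()
out     ≟ chan _  = no λ ()
out     ≟ ident _ = no λ ()
out     ≟ out     = yes refl

------------------------------------------------------------------------
-- Processes

-- Terms are taken up to alpha-conversion: free names are elements of Name,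
-- bound names are de Bruijn indices.  `Proc n` allows n dangling indices;
-- the processes of the calculus are the terms of `Proc 0`.
data Ref (n : ℕ) : Set where
  free  : Name → Ref n
  bound : Fin n → Ref n

infixr 6 _∣_
infix  7 !_

mutual

  data Proc (n : ℕ) : Set where
    sum : List (Branch n) → Proc n
    ν   : Proc (suc n) → Proc n
    _∣_ : Proc n → Proc n → Proc n
    !_  : Proc n → Proc n

  -- A summand α.P; index zero of the continuation of `input x` is the
  -- name bound by the prefix.
  data Branch (n : ℕ) : Set where
    input  : Ref n → Proc (suc n) → Branch n
    output : Ref n → Ref n → Proc n → Branch n
    silent : Proc n → Branch n

Process : Set
Process = Proc 0

-- The mixed-choice calculus is all of Process; the separate-choice
-- calculus is the subset cut out by Separate.
mutual

  data Separate {n : ℕ} : Proc n → Set where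
    sumᴵ : ∀ {bs} → All Branchᴵ bs → Separate (sum bs)
    sumᴼ : ∀ {bs} → All Branchᴼ bs → Separate (sum bs)
    ν    : ∀ {P} → Separate P → Separate (ν P)
    _∣_  : ∀ {P Q} → Separate P → Separate Q → Separate (P ∣ Q)
    !_   : ∀ {P} → Separate P → Separate (! P)

  data Branchᴵ {n : ℕ} : Branch n → Set where
    input  : ∀ {x P} → Separate P → Branchᴵ (input x P)
    silent : ∀ {P} → Separate P → Branchᴵ (silent P)

  data Branchᴼ {n : ℕ} : Branch n → Set where
    output : ∀ {x y P} → Separate P → Branchᴼ (output x y P)
    silent : ∀ {P} → Separate P → Branchᴼ (silent P)

------------------------------------------------------------------------
-- Free names and renaming

fnʳ : ∀ {n} → Ref n → List Name
fnʳ (free x)  = x ∷ []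
fnʳ (bound _) = []

mutual

  fn : ∀ {n} → Proc n → List Name
  fn (sum bs) = fnˢ bs
  fn (ν P)    = fn P
  fn (P ∣ Q)  = fn P ++ fn Q
  fn (! P)    = fn P

  fnˢ : ∀ {n} → List (Branch n) → List Name
  fnˢ []       = []
  fnˢ (b ∷ bs) = fnᵇ b ++ fnˢ bs

  fnᵇ : ∀ {n} → Branch n → List Name
  fnᵇ (input x P)    = fnʳ x ++ fn P
  fnᵇ (output x y P) = fnʳ x ++ fnʳ y ++ fn P
  fnᵇ (silent P)     = fn P

shift : ∀ {n} → Ref n → Ref (suc n)
shift (free x)  = free x
shift (bound i) = bound (suc i)

lift : ∀ {m n} → (Ref m → Ref n) → Ref (suc m) → Ref (suc n)
lift f (free x)        = shift (f (free x))
lift f (bound zero)    = bound zero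
lift f (bound (suc i)) = shift (f (bound i))

-- Simultaneous replacement of free names and dangling indices.
mutual

  rename : ∀ {m n} → (Ref m → Ref n) → Proc m → Proc n
  rename f (sum bs) = sum (renameˢ f bs)
  rename f (ν P)    = ν (rename (lift f) P)
  rename f (P ∣ Q)  = rename f P ∣ rename f Q
  rename f (! P)    = ! rename f P

  renameˢ : ∀ {m n} → (Ref m → Ref n) → List (Branch m) → List (Branch n)
  renameˢ f []       = []
  renameˢ f (b ∷ bs) = renameᵇ f b ∷ renameˢ f bs

  renameᵇ : ∀ {m n} → (Ref m → Ref n) → Branch m → Branch n
  renameᵇ f (input x P)    = input (f x) (rename (lift f) P)
  renameᵇ f (output x y P) = output (f x) (f y) (rename f P)
  renameᵇ f (silent P)     = silent (rename f P)

weaken : ∀ {n} → Proc n → Proc (suc n)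
weaken = rename shift

instʳ : Name → Ref 1 → Ref 0
instʳ y (free x)     = free x
instʳ y (bound zero) = free y

-- If P is the continuation of a prefix x(z), then P [ y ] is P{y/z}.
infix 8 _[_]

_[_] : Proc 1 → Name → Process
P [ y ] = rename (instʳ y) P

bindʳ : Name → Ref 0 → Ref 1
bindʳ x (free y) with y ≟ x
... | yes _ = bound zero
... | no  _ = free y

-- ν⟨ k ⟩ P is the term written νx P when x is the ordinary name chan k.
infixr 7 ν⟨_⟩_

ν⟨_⟩_ : ℕ → Process → Process
ν⟨ k ⟩ P = ν (rename (bindʳ (chan k)) P)

Permutation : Set
Permutation = Name ↔ Name

permuteʳ : ∀ {n} → Permutation → Ref n → Ref n
permuteʳ σ (free x)  = free (Inverse.to σ x)
permuteʳ σ (bound i) = bound i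

infixr 8 _·_

_·_ : Permutation → Process → Process
σ · P = rename (permuteʳ σ) P

------------------------------------------------------------------------
-- Structural congruence

-- Alpha-conversion is built into the syntax.  In `extrude`, weakening Q
-- makes the extruded name distinct from all free names of Q, which is the
-- side condition x ∉ fn(Q) up to alpha-conversion.
infix 4 _≅_ _≅ᵇ_

mutual

  data _≅_ {n : ℕ} : Proc n → Proc n → Set where
    extrude : ∀ {P Q} → ν P ∣ Q ≅ ν (P ∣ weaken Q)
    ≅-refl  : ∀ {P} → P ≅ P
    ≅-sym   : ∀ {P Q} → P ≅ Q → Q ≅ P
    ≅-trans : ∀ {P Q R} → P ≅ Q → Q ≅ R → P ≅ R
    ≅-sum   : ∀ {bs cs} → Pointwise _≅ᵇ_ bs cs → sum bs ≅ sum cs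
    ≅-ν     : ∀ {P Q} → P ≅ Q → ν P ≅ ν Q
    ≅-∣     : ∀ {P P′ Q Q′} → P ≅ P′ → Q ≅ Q′ → P ∣ Q ≅ P′ ∣ Q′
    ≅-!     : ∀ {P Q} → P ≅ Q → ! P ≅ ! Q

  data _≅ᵇ_ {n : ℕ} : Branch n → Branch n → Set where
    input  : ∀ {x P Q} → P ≅ Q → input x P ≅ᵇ input x Q
    output : ∀ {x y P Q} → P ≅ Q → output x y P ≅ᵇ output x y Q
    silent : ∀ {P Q} → P ≅ Q → silent P ≅ᵇ silent Q

------------------------------------------------------------------------
-- Transitions

-- recv x y is the input xy, send x y the free output x̄y, and sendν x k
-- the bound output x̄(y) with y the ordinary name chan k.
data Action : Set where
  recv  : Name → Name → Action
  send  : Name → Name → Action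
  sendν : Name → ℕ → Action
  τ     : Action

bn : Action → List Name
bn (sendν _ k) = chan k ∷ []
bn _           = []

names : Action → List Name
names (recv x y)  = x ∷ y ∷ []
names (send x y)  = x ∷ y ∷ []
names (sendν x k) = x ∷ chan k ∷ []
names τ           = []

infix 4 _—[_]→_

data _—[_]→_ : Process → Action → Process → Set where
  i-sum : ∀ {bs x P} y →
          input (free x) P ∈ bs → sum bs —[ recv x y ]→ P [ y ]
  o-sum : ∀ {bs x y P} →
          output (free x) (free y) P ∈ bs → sum bs —[ send x y ]→ P
  τ-sum : ∀ {bs P} →
          silent P ∈ bs → sum bs —[ τ ]→ P
  opening : ∀ {P P′ x k} →
          P —[ send x (chan k) ]→ P′ → x ≢ chan k →
          ν⟨ k ⟩ P —[ sendν x k ]→ P′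
  res   : ∀ {P P′ μ k} →
          P —[ μ ]→ P′ → chan k ∉ names μ →
          ν⟨ k ⟩ P —[ μ ]→ ν⟨ k ⟩ P′
  parˡ  : ∀ {P P′ Q μ} →
          P —[ μ ]→ P′ → Disjoint (bn μ) (fn Q) →
          P ∣ Q —[ μ ]→ P′ ∣ Q
  parʳ  : ∀ {P Q Q′ μ} →
          Q —[ μ ]→ Q′ → Disjoint (bn μ) (fn P) →
          P ∣ Q —[ μ ]→ P ∣ Q′
  comˡ  : ∀ {P P′ Q Q′ x y} →
          P —[ recv x y ]→ P′ → Q —[ send x y ]→ Q′ →
          P ∣ Q —[ τ ]→ P′ ∣ Q′
  comʳ  : ∀ {P P′ Q Q′ x y} →
          P —[ send x y ]→ P′ → Q —[ recv x y ]→ Q′ →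
          P ∣ Q —[ τ ]→ P′ ∣ Q′
  closeˡ : ∀ {P P′ Q Q′ x k} →
          P —[ recv x (chan k) ]→ P′ → Q —[ sendν x k ]→ Q′ →
          chan k ∉ fn P →
          P ∣ Q —[ τ ]→ ν⟨ k ⟩ (P′ ∣ Q′)
  closeʳ : ∀ {P P′ Q Q′ x k} →
          P —[ sendν x k ]→ P′ → Q —[ recv x (chan k) ]→ Q′ →
          chan k ∉ fn Q →
          P ∣ Q —[ τ ]→ ν⟨ k ⟩ (P′ ∣ Q′)
  rep   : ∀ {P P′ μ} →
          P ∣ ! P —[ μ ]→ P′ → ! P —[ μ ]→ P′
  struct : ∀ {P P′ Q Q′ μ} →
          P′ ≅ P → P —[ μ ]→ Q → Q ≅ Q′ → P′ —[ μ ]→ Q′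

------------------------------------------------------------------------
-- Computations and observables

subject : Action → Maybe Name
subject (recv x _)  = just x
subject (send x _)  = just x
subject (sendν x _) = just x
subject τ           = nothing

OnOut : Action → Set
OnOut μ = subject μ ≡ just out

-- The steps of a computation.  A process communicates with the external
-- world through `out` only, so a visible action on any other channel is
-- merely an offer to a partner inside the system and is not a step of a
-- computation by itself.
infix 4 _⇒_

_⇒_ : Process → Process → Set
P ⇒ Q = Σ[ μ ∈ Action ] (μ ≡ τ ⊎ OnOut μ) × (P —[ μ ]→ Q)

data Computation (P : Process) : Set where
  finite   : ∀ {Q} → Star _⇒_ P Q → Computation P
  infinite : (state : ℕ → Process) → state 0 ≡ P →
             (∀ n → state n ⇒ state (suc n)) → Computation P

Maximal : ∀ {P} → Computation P → Set
Maximal (finite {Q} _)   = ¬ ∃ λ R → Q ⇒ R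
Maximal (infinite _ _ _) = ⊤

actions : ∀ {P Q} → Star _⇒_ P Q → List Action
actions ε       = []
actions (s ◅ r) = proj₁ s ∷ actions r

Performs : ∀ {P} → Computation P → Action → Set
Performs (finite r)           μ = μ ∈ actions r
Performs (infinite _ _ steps) μ = ∃ λ n → proj₁ (steps n) ≡ μ

Observable : ∀ {P} → Computation P → Action → Set
Observable C μ = Performs C μ × OnOut μ

-- The observables of a computation form a set of actions.  Comparing
-- sequences or multisets instead would separate more computations, so
-- every semantics reasonable in that sense is Reasonable below.
SameObservables : ∀ {P Q} → Computation P → Computation Q → Set
SameObservables C D = ∀ μ → Observable C μ ⇔ Observable D μ

------------------------------------------------------------------------
-- Semantics and encodings

Distinguishes : ∀ {ℓ} → Rel Process ℓ → Process → Process → Set ℓ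
Distinguishes _≈_ P Q = ¬ (P ≈ Q)

Reasonable : ∀ {ℓ} → Rel Process ℓ → Set ℓ
Reasonable _≈_ = ∀ P Q →
  (Σ[ C ∈ Computation P ] Maximal C ×
     (∀ (D : Computation Q) → Maximal D → ¬ SameObservables C D)) →
  Distinguishes _≈_ P Q

record Encoding : Set where
  field
    ⟦_⟧      : Process → Process
    separate : ∀ P → Separate ⟦ P ⟧

record Uniform (E : Encoding) : Set where
  open Encoding E
  field
    parallel : ∀ P Q → ⟦ P ∣ Q ⟧ ≡ ⟦ P ⟧ ∣ ⟦ Q ⟧
    renamed  : ∀ (σ : Permutation) → Σ[ θ ∈ Permutation ]
                 (∀ i → Inverse.to σ (ident i) ≡ Inverse.to θ (ident i)) ×
                 (∀ P → ⟦ σ · P ⟧ ≡ θ · ⟦ P ⟧)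

Preserves : ∀ {ℓ} → Encoding → Rel Process ℓ → Set ℓ
Preserves E _≈_ = ∀ P → ¬ Distinguishes _≈_ P ⟦ P ⟧
  where open Encoding E

{-# OPTIONS --safe #-}
module Submission where

-- The network a(y).out⟨0⟩ + a⟨a⟩ ∣ a(y).out⟨1⟩ + a⟨a⟩ of the mixed-choice
-- calculus announces exactly one of 0 and 1 on every maximal computation,
-- and its right half is the left one with 0 and 1 transposed.  Uniformity
-- forces the encoding of the network to have the form Q ∣ σQ, with σ the
-- transposition of the two identifiers: σ and its companion θ agree on every
-- name, because every name is the image of an identifier under a permutation.
--
-- In a separate-choice process an output and an input that are both enabled
-- belong to different sums, so neither disables the other.  Hence from
-- ν⋯ν (Q ∣ σQ), with σ extended to the restricted names, any internal step
-- can be completed by its mirror image to reach a configuration of the same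
-- form.  Either this goes on forever without observables, or it gets stuck;
-- then nothing is observable or each action on out can be followed by its
-- mirror image.  None of these computations announces exactly one identifier.
--
-- Infinite computations have to be constructed, so it must be decidable
-- whether a process can move.  This is read off the syntax: P ↓ o says that P
-- has an action of kind o, and ↓ is invariant under structural congruence.

open import Defs
open import Data.Bool using (Bool; true; false)
open import Data.Empty using (⊥; ⊥-elim)
open import Data.Fin using (zero; suc)
import Data.Fin.Properties as Fin
open import Data.List using (List; []; _∷_; _++_)
open import Data.List.Membership.Propositional using (_∈_; _∉_; find; lose)
open import Data.List.Membership.Propositional.Properties using (∈-++⁺ˡ; ∈-++⁺ʳ; ∈-++⁻)
open import Data.List.Properties using (∷-injectiveˡ; ∷-injectiveʳ)
open import Data.List.Relation.Binary.Pointwise using (Pointwise; []; _∷_)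
open import Data.List.Relation.Unary.All as All using (All; []; _∷_)
open import Data.List.Relation.Unary.Any as Any using (here; there)
open import Data.Nat using (ℕ; zero; suc; _⊔_; _≤_)
import Data.Nat.Properties as ℕₚ
open import Data.Product using (Σ; Σ-syntax; ∃; ∃₂; _×_; _,_; proj₁; proj₂; swap)
open import Data.Sum as Sum using (_⊎_; inj₁; inj₂; [_,_]′)
open import Data.Unit using (tt)
open import Function.Base using (_∘_; id)
open import Function.Bundles using (Inverse; Equivalence; mk↔ₛ′)
open import Function.Construct.Composition using (_↔-∘_)
open import Function.Definitions using (Injective)
open import Level using (0ℓ)
open import Relation.Binary.Construct.Closure.ReflexiveTransitive as Star
  using (Star; ε; _◅_; _◅◅_)
open import Relation.Binary.Core using (Rel)
open import Relation.Binary.Definitions using (DecidableEquality)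
open import Relation.Binary.PropositionalEquality
  using (_≡_; _≢_; refl; sym; trans; cong; cong₂; subst; _≗_; module ≡-Reasoning)
open import Relation.Binary.Structures using (IsEquivalence)
open import Relation.Nullary using (¬_; Dec; yes; no)
open import Relation.Nullary.Decidable using (map′; _⊎-dec_; _×-dec_)

private variable
  l m n : ℕ
  d : Bool

-- Renaming

shift-injective : {r s : Ref n} → shift r ≡ shift s → r ≡ s
shift-injective {r = free x}  {free .x}  refl = refl
shift-injective {r = bound i} {bound .i} refl = refl

lift-shift : (f : Ref m → Ref n) → lift f ∘ shift ≗ shift ∘ f
lift-shift f (free x)  = refl
lift-shift f (bound i) = refl

-- `fn` lists names only, so agreement is demanded on every dangling index but merely on the listed
-- names.
record Agree (f g : Ref m → Ref n) (xs : List Name) : Set where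
  constructor agree
  field
    on-bound : ∀ i → f (bound i) ≡ g (bound i)
    on-free  : ∀ {x} → x ∈ xs → f (free x) ≡ g (free x)

module _ {f g : Ref m → Ref n} where

  agree-++ˡ : ∀ {xs ys} → Agree f g (xs ++ ys) → Agree f g xs
  agree-++ˡ (agree b e) = agree b (e ∘ ∈-++⁺ˡ)

  agree-++ʳ : ∀ xs {ys} → Agree f g (xs ++ ys) → Agree f g ys
  agree-++ʳ xs (agree b e) = agree b (e ∘ ∈-++⁺ʳ xs)

  agree-lift : ∀ {xs} → Agree f g xs → Agree (lift f) (lift g) xs
  agree-lift (agree b e) =
    agree (λ { zero → refl ; (suc i) → cong shift (b i) }) (cong shift ∘ e)

  agree-ref : ∀ r → Agree f g (fnʳ r) → f r ≡ g r
  agree-ref (free x)  (agree _ e) = e (here refl)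
  agree-ref (bound i) (agree b _) = b i

output-cong : {x x′ y y′ : Ref n} {P P′ : Proc n} →
              x ≡ x′ → y ≡ y′ → P ≡ P′ → output x y P ≡ output x′ y′ P′
output-cong refl refl refl = refl

mutual

  rename-agree : {f g : Ref m → Ref n} (P : Proc m) →
                 Agree f g (fn P) → rename f P ≡ rename g P
  rename-agree (sum bs) e = cong sum (rename-agreeˢ bs e)
  rename-agree (ν P)    e = cong ν (rename-agree P (agree-lift e))
  rename-agree (P ∣ Q)  e = cong₂ _∣_ (rename-agree P (agree-++ˡ e))
                                      (rename-agree Q (agree-++ʳ (fn P) e))
  rename-agree (! P)    e = cong !_ (rename-agree P e)

  rename-agreeˢ : {f g : Ref m → Ref n} (bs : List (Branch m)) →
                  Agree f g (fnˢ bs) → renameˢ f bs ≡ renameˢ g bs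
  rename-agreeˢ []       e = refl
  rename-agreeˢ (b ∷ bs) e = cong₂ _∷_ (rename-agreeᵇ b (agree-++ˡ e))
                                       (rename-agreeˢ bs (agree-++ʳ (fnᵇ b) e))

  rename-agreeᵇ : {f g : Ref m → Ref n} (b : Branch m) →
                  Agree f g (fnᵇ b) → renameᵇ f b ≡ renameᵇ g b
  rename-agreeᵇ (input x P) e =
    cong₂ input (agree-ref x (agree-++ˡ e))
                (rename-agree P (agree-lift (agree-++ʳ (fnʳ x) e)))
  rename-agreeᵇ (output x y P) e =
    output-cong (agree-ref x (agree-++ˡ e))
                (agree-ref y (agree-++ˡ (agree-++ʳ (fnʳ x) e)))
                (rename-agree P (agree-++ʳ (fnʳ y) (agree-++ʳ (fnʳ x) e)))
  rename-agreeᵇ (silent P) e = cong silent (rename-agree P e)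

rename-cong : {f g : Ref m → Ref n} → f ≗ g → rename f ≗ rename g
rename-cong e P = rename-agree P (agree (e ∘ bound) (λ {x} _ → e (free x)))

lift-∘ : {f : Ref l → Ref m} {g : Ref m → Ref n} {h : Ref l → Ref n} →
         g ∘ f ≗ h → lift g ∘ lift f ≗ lift h
lift-∘ {g = g} e (free x)        = trans (lift-shift g _) (cong shift (e (free x)))
lift-∘ {g = g} e (bound zero)    = refl
lift-∘ {g = g} e (bound (suc i)) = trans (lift-shift g _) (cong shift (e (bound i)))

mutual

  -- The composite enters as a function `h` with a pointwise equation, so that the induction passes
  -- under binders by `lift-∘` without function extensionality.
  rename-∘ : {f : Ref l → Ref m} {g : Ref m → Ref n} {h : Ref l → Ref n} →
             g ∘ f ≗ h → rename g ∘ rename f ≗ rename h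
  rename-∘ e (sum bs) = cong sum (rename-∘ˢ e bs)
  rename-∘ e (ν P)    = cong ν (rename-∘ (lift-∘ e) P)
  rename-∘ e (P ∣ Q)  = cong₂ _∣_ (rename-∘ e P) (rename-∘ e Q)
  rename-∘ e (! P)    = cong !_ (rename-∘ e P)

  rename-∘ˢ : {f : Ref l → Ref m} {g : Ref m → Ref n} {h : Ref l → Ref n} →
              g ∘ f ≗ h → renameˢ g ∘ renameˢ f ≗ renameˢ h
  rename-∘ˢ e []       = refl
  rename-∘ˢ e (b ∷ bs) = cong₂ _∷_ (rename-∘ᵇ e b) (rename-∘ˢ e bs)

  rename-∘ᵇ : {f : Ref l → Ref m} {g : Ref m → Ref n} {h : Ref l → Ref n} →
              g ∘ f ≗ h → renameᵇ g ∘ renameᵇ f ≗ renameᵇ h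
  rename-∘ᵇ e (input x P) = cong₂ input (e x) (rename-∘ (lift-∘ e) P)
  rename-∘ᵇ e (output x y P) = output-cong (e x) (e y) (rename-∘ e P)
  rename-∘ᵇ e (silent P) = cong silent (rename-∘ e P)

rename-square : ∀ {k} {f : Ref k → Ref l} {g : Ref l → Ref n}
                {f′ : Ref k → Ref m} {g′ : Ref m → Ref n} →
                g ∘ f ≗ g′ ∘ f′ → rename g ∘ rename f ≗ rename g′ ∘ rename f′
rename-square e P = trans (rename-∘ e P) (sym (rename-∘ (λ _ → refl) P))

mutual

  rename-id : {f : Ref n → Ref n} → f ≗ id → rename f ≗ id
  rename-id e (sum bs) = cong sum (rename-idˢ e bs)
  rename-id e (ν P)    = cong ν (rename-id (lift-id e) P)
  rename-id e (P ∣ Q)  = cong₂ _∣_ (rename-id e P) (rename-id e Q)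
  rename-id e (! P)    = cong !_ (rename-id e P)

  rename-idˢ : {f : Ref n → Ref n} → f ≗ id → renameˢ f ≗ id
  rename-idˢ e []       = refl
  rename-idˢ e (b ∷ bs) = cong₂ _∷_ (rename-idᵇ e b) (rename-idˢ e bs)

  rename-idᵇ : {f : Ref n → Ref n} → f ≗ id → renameᵇ f ≗ id
  rename-idᵇ e (input x P) = cong₂ input (e x) (rename-id (lift-id e) P)
  rename-idᵇ e (output x y P) = output-cong (e x) (e y) (rename-id e P)
  rename-idᵇ e (silent P) = cong silent (rename-id e P)

  lift-id : {f : Ref n → Ref n} → f ≗ id → lift f ≗ id
  lift-id e (free x)        = cong shift (e (free x))
  lift-id e (bound zero)    = refl
  lift-id e (bound (suc i)) = cong shift (e (bound i))

-- Free names

∈-++-case : ∀ {A : Set} {x : Name} {xs ys} →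
            (x ∈ xs → A) → (x ∈ ys → A) → x ∈ xs ++ ys → A
∈-++-case {xs = xs} f g x∈ with ∈-++⁻ xs x∈
... | inj₁ x∈xs = f x∈xs
... | inj₂ x∈ys = g x∈ys

-- Besides the image of a free name, a free name of `rename f P` may be what `f` puts in for a
-- dangling index, as happens in `P [ y ]`.
data Origin (f : Ref m → Ref n) (xs : List Name) (x : Name) : Set where
  free  : ∀ {y} → y ∈ xs → f (free y) ≡ free x → Origin f xs x
  bound : ∀ i → f (bound i) ≡ free x → Origin f xs x

shift-free : ∀ {r : Ref n} {x} → shift r ≡ free x → r ≡ free x
shift-free {r = free _} refl = refl

origin-map : ∀ {f : Ref m → Ref n} {x xs ys} →
             (∀ {y} → y ∈ xs → y ∈ ys) → Origin f xs x → Origin f ys x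
origin-map g (free y∈ e) = free (g y∈) e
origin-map g (bound i e) = bound i e

origin-unlift : ∀ {f : Ref m → Ref n} {x xs} → Origin (lift f) xs x → Origin f xs x
origin-unlift (free y∈ e)       = free y∈ (shift-free e)
origin-unlift (bound (suc i) e) = bound i (shift-free e)

origin-ref : ∀ {f : Ref m → Ref n} {x} r → x ∈ fnʳ (f r) → Origin f (fnʳ r) x
origin-ref {f = f} (free y) x∈ with f (free y) in eq
origin-ref (free y) (here refl) | free x = free (here refl) eq
origin-ref {f = f} (bound i) x∈ with f (bound i) in eq
origin-ref (bound i) (here refl) | free x = bound i eq

mutual

  fn-rename⁻ : ∀ {f : Ref m → Ref n} {x} (P : Proc m) →
               x ∈ fn (rename f P) → Origin f (fn P) x
  fn-rename⁻ (sum bs) = fn-rename⁻ˢ bs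
  fn-rename⁻ (ν P)    = origin-unlift ∘ fn-rename⁻ P
  fn-rename⁻ (P ∣ Q)  = ∈-++-case (origin-map ∈-++⁺ˡ ∘ fn-rename⁻ P)
                                  (origin-map (∈-++⁺ʳ (fn P)) ∘ fn-rename⁻ Q)
  fn-rename⁻ (! P)    = fn-rename⁻ P

  fn-rename⁻ˢ : ∀ {f : Ref m → Ref n} {x} (bs : List (Branch m)) →
                x ∈ fnˢ (renameˢ f bs) → Origin f (fnˢ bs) x
  fn-rename⁻ˢ (b ∷ bs) = ∈-++-case (origin-map ∈-++⁺ˡ ∘ fn-rename⁻ᵇ b)
                                   (origin-map (∈-++⁺ʳ (fnᵇ b)) ∘ fn-rename⁻ˢ bs)

  fn-rename⁻ᵇ : ∀ {f : Ref m → Ref n} {x} (b : Branch m) →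
                x ∈ fnᵇ (renameᵇ f b) → Origin f (fnᵇ b) x
  fn-rename⁻ᵇ (input y P) =
    ∈-++-case (origin-map ∈-++⁺ˡ ∘ origin-ref y)
              (origin-map (∈-++⁺ʳ (fnʳ y)) ∘ origin-unlift ∘ fn-rename⁻ P)
  fn-rename⁻ᵇ (output y z P) =
    ∈-++-case (origin-map ∈-++⁺ˡ ∘ origin-ref y)
      (origin-map (∈-++⁺ʳ (fnʳ y)) ∘
       ∈-++-case (origin-map ∈-++⁺ˡ ∘ origin-ref z)
                 (origin-map (∈-++⁺ʳ (fnʳ z)) ∘ fn-rename⁻ P))
  fn-rename⁻ᵇ (silent P) = fn-rename⁻ P

fn-ref⁺ : ∀ (f : Ref m → Ref n) {x y} r →
          f (free y) ≡ free x → y ∈ fnʳ r → x ∈ fnʳ (f r)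
fn-ref⁺ f (free y) e (here refl) rewrite e = here refl

∈-++-map : ∀ {x y : Name} {xs ys xs′ ys′ : List Name} →
           (x ∈ xs → y ∈ xs′) → (x ∈ ys → y ∈ ys′) → x ∈ xs ++ ys → y ∈ xs′ ++ ys′
∈-++-map {xs′ = xs′} f g = ∈-++-case (∈-++⁺ˡ ∘ f) (∈-++⁺ʳ xs′ ∘ g)

mutual

  fn-rename⁺ : ∀ {f : Ref m → Ref n} {x y} (P : Proc m) →
               f (free y) ≡ free x → y ∈ fn P → x ∈ fn (rename f P)
  fn-rename⁺ (sum bs) e = fn-rename⁺ˢ bs e
  fn-rename⁺ (ν P)    e = fn-rename⁺ P (cong shift e)
  fn-rename⁺ (P ∣ Q)  e = ∈-++-map (fn-rename⁺ P e) (fn-rename⁺ Q e)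
  fn-rename⁺ (! P)    e = fn-rename⁺ P e

  fn-rename⁺ˢ : ∀ {f : Ref m → Ref n} {x y} (bs : List (Branch m)) →
                f (free y) ≡ free x → y ∈ fnˢ bs → x ∈ fnˢ (renameˢ f bs)
  fn-rename⁺ˢ (b ∷ bs) e = ∈-++-map (fn-rename⁺ᵇ b e) (fn-rename⁺ˢ bs e)

  fn-rename⁺ᵇ : ∀ {f : Ref m → Ref n} {x y} (b : Branch m) →
                f (free y) ≡ free x → y ∈ fnᵇ b → x ∈ fnᵇ (renameᵇ f b)
  fn-rename⁺ᵇ {f = f} (input z P) e =
    ∈-++-map (fn-ref⁺ f z e) (fn-rename⁺ P (cong shift e))
  fn-rename⁺ᵇ {f = f} (output z w P) e =
    ∈-++-map (fn-ref⁺ f z e)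
             (∈-++-map (fn-ref⁺ f w e) (fn-rename⁺ P e))
  fn-rename⁺ᵇ (silent P) e = fn-rename⁺ P e

fn-weaken⁻ : ∀ {x} (P : Proc n) → x ∈ fn (weaken P) → x ∈ fn P
fn-weaken⁻ P x∈ with fn-rename⁻ P x∈
... | free y∈ refl = y∈

fn-[]⁻ : ∀ {x y} (P : Proc 1) → x ≢ y → x ∈ fn (P [ y ]) → x ∈ fn P
fn-[]⁻ P x≢y x∈ with fn-rename⁻ P x∈
... | free y∈ refl    = y∈
... | bound zero refl = ⊥-elim (x≢y refl)

bindʳ-≡ : ∀ x → bindʳ x (free x) ≡ bound zero
bindʳ-≡ x with x ≟ x
... | yes _  = refl
... | no x≢x = ⊥-elim (x≢x refl)

bindʳ-≢ : ∀ {x y} → y ≢ x → bindʳ x (free y) ≡ free y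
bindʳ-≢ {x} {y} y≢x with y ≟ x
... | yes y≡x = ⊥-elim (y≢x y≡x)
... | no _    = refl

fn-ν⁺ : ∀ {x k} P → x ≢ chan k → x ∈ fn P → x ∈ fn (ν⟨ k ⟩ P)
fn-ν⁺ P x≢k = fn-rename⁺ P (bindʳ-≢ x≢k)

fn-ν⁻ : ∀ {x k} P → x ∈ fn (ν⟨ k ⟩ P) → x ∈ fn P
fn-ν⁻ {k = k} P x∈ with fn-rename⁻ P x∈
... | free {y} y∈ e with y ≟ chan k
fn-ν⁻ P x∈ | free y∈ refl | no _ = y∈
fn-ν⁻ P x∈ | free y∈ ()   | yes _

-- Recovering a renaming from its result

sum-injective : {bs cs : List (Branch n)} → sum bs ≡ sum cs → bs ≡ cs
sum-injective refl = refl

ν-injective : {P Q : Proc (suc n)} → ν P ≡ ν Q → P ≡ Q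
ν-injective refl = refl

∣-injective : {P P′ Q Q′ : Proc n} → P ∣ Q ≡ P′ ∣ Q′ → P ≡ P′ × Q ≡ Q′
∣-injective refl = refl , refl

!-injective : {P Q : Proc n} → ! P ≡ ! Q → P ≡ Q
!-injective refl = refl

input-injective : {x y : Ref n} {P Q : Proc (suc n)} →
                  input x P ≡ input y Q → x ≡ y × P ≡ Q
input-injective refl = refl , refl

output-injective : {x x′ y y′ : Ref n} {P P′ : Proc n} →
                   output x y P ≡ output x′ y′ P′ → x ≡ x′ × y ≡ y′ × P ≡ P′
output-injective refl = refl , refl , refl

silent-injective : {P Q : Proc n} → silent P ≡ silent Q → P ≡ Q
silent-injective refl = refl

rename-determinesʳ : ∀ (f g : Ref m → Ref n) {x} r →
                     f r ≡ g r → x ∈ fnʳ r → f (free x) ≡ g (free x)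
rename-determinesʳ _ _ (free _) e (here refl) = e

mutual

  -- Constructors are injective, so the value of a renaming at each free name can be read off the
  -- result. This turns equations between encoded terms into equations between names.
  rename-determines : ∀ {f g : Ref m → Ref n} {x} (P : Proc m) →
                      rename f P ≡ rename g P → x ∈ fn P → f (free x) ≡ g (free x)
  rename-determines (sum bs) e = rename-determinesˢ bs (sum-injective e)
  rename-determines (ν P) e = shift-injective ∘ rename-determines P (ν-injective e)
  rename-determines (P ∣ Q) e with ∣-injective e
  ... | eᴾ , eᴼ = ∈-++-case (rename-determines P eᴾ) (rename-determines Q eᴼ)
  rename-determines (! P) e = rename-determines P (!-injective e)

  rename-determinesˢ : ∀ {f g : Ref m → Ref n} {x} (bs : List (Branch m)) →
                       renameˢ f bs ≡ renameˢ g bs → x ∈ fnˢ bs → f (free x) ≡ g (free x)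
  rename-determinesˢ (b ∷ bs) e = ∈-++-case (rename-determinesᵇ b (∷-injectiveˡ e))
                                            (rename-determinesˢ bs (∷-injectiveʳ e))

  rename-determinesᵇ : ∀ {f g : Ref m → Ref n} {x} (b : Branch m) →
                       renameᵇ f b ≡ renameᵇ g b → x ∈ fnᵇ b → f (free x) ≡ g (free x)
  rename-determinesᵇ {f = f} {g} (input y P) e with input-injective e
  ... | eʸ , eᴾ = ∈-++-case (rename-determinesʳ f g y eʸ)
                            (shift-injective ∘ rename-determines P eᴾ)
  rename-determinesᵇ {f = f} {g} (output y z P) e with output-injective e
  ... | eʸ , eᶻ , eᴾ = ∈-++-case (rename-determinesʳ f g y eʸ)
                         (∈-++-case (rename-determinesʳ f g z eᶻ) (rename-determines P eᴾ))
  rename-determinesᵇ (silent P) e = rename-determines P (silent-injective e)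

-- Free names under structural congruence and transitions

mutual

  fn-≅ : ∀ {P Q : Proc n} {x} → P ≅ Q →
         (x ∈ fn P → x ∈ fn Q) × (x ∈ fn Q → x ∈ fn P)
  fn-≅ (extrude {P} {Q}) = ∈-++-map id (fn-rename⁺ Q refl) , ∈-++-map id (fn-weaken⁻ Q)
  fn-≅ ≅-refl         = id , id
  fn-≅ (≅-sym e)      = swap (fn-≅ e)
  fn-≅ (≅-trans e e′) = proj₁ (fn-≅ e′) ∘ proj₁ (fn-≅ e) , proj₂ (fn-≅ e) ∘ proj₂ (fn-≅ e′)
  fn-≅ (≅-sum es)     = fn-≅ˢ es
  fn-≅ (≅-ν e)        = fn-≅ e
  fn-≅ (≅-∣ e e′)     = ∈-++-map (proj₁ (fn-≅ e)) (proj₁ (fn-≅ e′)) ,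
                        ∈-++-map (proj₂ (fn-≅ e)) (proj₂ (fn-≅ e′))
  fn-≅ (≅-! e)        = fn-≅ e

  fn-≅ˢ : ∀ {bs cs : List (Branch n)} {x} → Pointwise _≅ᵇ_ bs cs →
          (x ∈ fnˢ bs → x ∈ fnˢ cs) × (x ∈ fnˢ cs → x ∈ fnˢ bs)
  fn-≅ˢ []       = id , id
  fn-≅ˢ (e ∷ es) = ∈-++-map (proj₁ (fn-≅ᵇ e)) (proj₁ (fn-≅ˢ es)) ,
                   ∈-++-map (proj₂ (fn-≅ᵇ e)) (proj₂ (fn-≅ˢ es))

  fn-≅ᵇ : ∀ {b c : Branch n} {x} → b ≅ᵇ c →
          (x ∈ fnᵇ b → x ∈ fnᵇ c) × (x ∈ fnᵇ c → x ∈ fnᵇ b)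
  fn-≅ᵇ (input {x} e)      = ∈-++-map {xs = fnʳ x} id (proj₁ (fn-≅ e)) ,
                             ∈-++-map {xs = fnʳ x} id (proj₂ (fn-≅ e))
  fn-≅ᵇ (output {x} {y} e) =
    ∈-++-map {xs = fnʳ x} id (∈-++-map {xs = fnʳ y} id (proj₁ (fn-≅ e))) ,
    ∈-++-map {xs = fnʳ x} id (∈-++-map {xs = fnʳ y} id (proj₂ (fn-≅ e)))
  fn-≅ᵇ (silent e)         = fn-≅ e

fn-branch : ∀ {b : Branch n} {bs x} → b ∈ bs → x ∈ fnᵇ b → x ∈ fnˢ bs
fn-branch (here refl)         = ∈-++⁺ˡ
fn-branch (there {x = b} b∈)  = ∈-++⁺ʳ (fnᵇ b) ∘ fn-branch b∈

-- Identifiers, never being bound, enter a process by input only.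
ident-fresh : ∀ {P P′ μ i} → P —[ μ ]→ P′ → ident i ∉ fn P →
              (∀ x → μ ≢ recv x (ident i)) →
              ident i ∉ names μ × ident i ∉ fn P′
ident-fresh (i-sum {P = P} y b∈) i∉ μ≢ =
  (λ { (here refl) → i∉ (fn-branch b∈ (here refl)) ; (there (here refl)) → μ≢ _ refl }) ,
  i∉ ∘ fn-branch b∈ ∘ there ∘ fn-[]⁻ P (λ { refl → μ≢ _ refl })
ident-fresh (o-sum b∈) i∉ μ≢ =
  (λ { (here refl) → i∉ (fn-branch b∈ (here refl))
     ; (there (here refl)) → i∉ (fn-branch b∈ (there (here refl))) }) ,
  i∉ ∘ fn-branch b∈ ∘ there ∘ there
ident-fresh (τ-sum b∈) i∉ μ≢ = (λ ()) , i∉ ∘ fn-branch b∈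
ident-fresh (opening {P = P} {P′} t _) i∉ μ≢
  with ident-fresh t (i∉ ∘ fn-ν⁺ P λ ()) (λ _ ())
... | i∉μ , i∉P′ = i∉μ , i∉P′
ident-fresh (res {P = P} {P′} t _) i∉ μ≢
  with ident-fresh t (i∉ ∘ fn-ν⁺ P λ ()) μ≢
... | i∉μ , i∉P′ = i∉μ , i∉P′ ∘ fn-ν⁻ P′
ident-fresh (parˡ {P = P} t _) i∉ μ≢ with ident-fresh t (i∉ ∘ ∈-++⁺ˡ) μ≢
... | i∉μ , i∉P′ = i∉μ , ∈-++-case i∉P′ (i∉ ∘ ∈-++⁺ʳ (fn P))
ident-fresh (parʳ {P = P} t _) i∉ μ≢ with ident-fresh t (i∉ ∘ ∈-++⁺ʳ (fn P)) μ≢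
... | i∉μ , i∉Q′ = i∉μ , ∈-++-case (i∉ ∘ ∈-++⁺ˡ) i∉Q′
-- The sender is treated first: the name it transmits is not `ident i`, hence the receiver does not
-- receive `ident i` either.
ident-fresh (comˡ {P = P} t u) i∉ μ≢ with ident-fresh u (i∉ ∘ ∈-++⁺ʳ (fn P)) (λ _ ())
... | i∉u , i∉Q′
  with ident-fresh t (i∉ ∘ ∈-++⁺ˡ) (λ { _ refl → i∉u (there (here refl)) })
... | _ , i∉P′ = (λ ()) , ∈-++-case i∉P′ i∉Q′
ident-fresh (comʳ {P = P} t u) i∉ μ≢ with ident-fresh t (i∉ ∘ ∈-++⁺ˡ) (λ _ ())
... | i∉t , i∉P′
  with ident-fresh u (i∉ ∘ ∈-++⁺ʳ (fn P)) (λ { _ refl → i∉t (there (here refl)) })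
... | _ , i∉Q′ = (λ ()) , ∈-++-case i∉P′ i∉Q′
-- The transmitted name is an ordinary one and so never an identifier.
ident-fresh (closeˡ {P = P} {P′} {Q} {Q′} t u _) i∉ μ≢ =
  (λ ()) , ∈-++-case (proj₂ (ident-fresh t (i∉ ∘ ∈-++⁺ˡ) (λ _ ())))
                     (proj₂ (ident-fresh u (i∉ ∘ ∈-++⁺ʳ (fn P)) (λ _ ())))
           ∘ fn-ν⁻ (P′ ∣ Q′)
ident-fresh (closeʳ {P = P} {P′} {Q} {Q′} t u _) i∉ μ≢ =
  (λ ()) , ∈-++-case (proj₂ (ident-fresh t (i∉ ∘ ∈-++⁺ˡ) (λ _ ())))
                     (proj₂ (ident-fresh u (i∉ ∘ ∈-++⁺ʳ (fn P)) (λ _ ())))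
           ∘ fn-ν⁻ (P′ ∣ Q′)
ident-fresh (rep {P = P} t) i∉ μ≢ = ident-fresh t (∈-++-case i∉ i∉) μ≢
ident-fresh (struct e t e′) i∉ μ≢ with ident-fresh t (i∉ ∘ proj₂ (fn-≅ e)) μ≢
... | i∉μ , i∉Q = i∉μ , i∉Q ∘ proj₂ (fn-≅ e′)

-- Offers

-- An action with its object forgotten: whether two prefixes can interact depends on the channel
-- alone.
data Offer (n : ℕ) : Set where
  receives sends : Ref n → Offer n
  internal       : Offer n

mapᵒ : (Ref m → Ref n) → Offer m → Offer n
mapᵒ f (receives x) = receives (f x)
mapᵒ f (sends x)    = sends (f x)
mapᵒ f internal     = internal

mapᵒ-square : ∀ {k} {f : Ref k → Ref l} {g : Ref l → Ref n}
              {f′ : Ref k → Ref m} {g′ : Ref m → Ref n} →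
              g ∘ f ≗ g′ ∘ f′ → mapᵒ g ∘ mapᵒ f ≗ mapᵒ g′ ∘ mapᵒ f′
mapᵒ-square e (receives x) = cong receives (e x)
mapᵒ-square e (sends x)    = cong sends (e x)
mapᵒ-square e internal     = refl

receives-injective : {x y : Ref n} → receives x ≡ receives y → x ≡ y
receives-injective refl = refl

sends-injective : {x y : Ref n} → sends x ≡ sends y → x ≡ y
sends-injective refl = refl

mapᵒ-injective : {f : Ref m → Ref n} → Injective _≡_ _≡_ f → Injective _≡_ _≡_ (mapᵒ f)
mapᵒ-injective inj {receives _} {receives _} e = cong receives (inj (receives-injective e))
mapᵒ-injective inj {sends _}    {sends _}    e = cong sends (inj (sends-injective e))
mapᵒ-injective inj {internal}   {internal}   e = refl

offerᵇ : Branch n → Offer n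
offerᵇ (input x _)    = receives x
offerᵇ (output x _ _) = sends x
offerᵇ (silent _)     = internal

infix 4 _↓_

-- Replication is described through `P` alone, with `repcom` for a communication between two copies,
-- instead of through `P ∣ ! P`. The relation thus follows the structure of the process, which makes
-- it decidable; `↓-rep⁻` shows that unfolding adds no offers.
data _↓_ {n : ℕ} : Proc n → Offer n → Set where
  sum    : ∀ {bs b o} → b ∈ bs → offerᵇ b ≡ o → sum bs ↓ o
  ν      : ∀ {P o} → P ↓ mapᵒ shift o → ν P ↓ o
  parˡ   : ∀ {P Q o} → P ↓ o → P ∣ Q ↓ o
  parʳ   : ∀ {P Q o} → Q ↓ o → P ∣ Q ↓ o
  comˡ   : ∀ {P Q x} → P ↓ receives x → Q ↓ sends x → P ∣ Q ↓ internal
  comʳ   : ∀ {P Q x} → P ↓ sends x → Q ↓ receives x → P ∣ Q ↓ internal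
  rep    : ∀ {P o} → P ↓ o → ! P ↓ o
  repcom : ∀ {P x} → P ↓ receives x → P ↓ sends x → ! P ↓ internal

rename-∈ : ∀ (f : Ref m → Ref n) {b bs} → b ∈ bs → renameᵇ f b ∈ renameˢ f bs
rename-∈ f (here refl) = here refl
rename-∈ f (there b∈)  = there (rename-∈ f b∈)

rename-∈⁻ : ∀ (f : Ref m → Ref n) {c} bs → c ∈ renameˢ f bs →
            ∃ λ b → b ∈ bs × c ≡ renameᵇ f b
rename-∈⁻ f (b ∷ bs) (here refl) = b , here refl , refl
rename-∈⁻ f (b ∷ bs) (there c∈) with rename-∈⁻ f bs c∈
... | b′ , b′∈ , e = b′ , there b′∈ , e

offerᵇ-rename : (f : Ref m → Ref n) → ∀ b → offerᵇ (renameᵇ f b) ≡ mapᵒ f (offerᵇ b)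
offerᵇ-rename f (input _ _)    = refl
offerᵇ-rename f (output _ _ _) = refl
offerᵇ-rename f (silent _)     = refl

↓-rename : (f : Ref m → Ref n) → ∀ {P o} → P ↓ o → rename f P ↓ mapᵒ f o
↓-rename f (sum {b = b} b∈ refl) = sum (rename-∈ f b∈) (offerᵇ-rename f b)
↓-rename f (ν {o = o} d)   =
  ν (subst (_ ↓_) (mapᵒ-square (lift-shift f) o) (↓-rename (lift f) d))
↓-rename f (parˡ d)        = parˡ (↓-rename f d)
↓-rename f (parʳ d)        = parʳ (↓-rename f d)
↓-rename f (comˡ d e)      = comˡ (↓-rename f d) (↓-rename f e)
↓-rename f (comʳ d e)      = comʳ (↓-rename f d) (↓-rename f e)
↓-rename f (rep d)         = rep (↓-rename f d)
↓-rename f (repcom d e)    = repcom (↓-rename f d) (↓-rename f e)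

shift≢zero : {r : Ref n} → shift r ≢ bound zero
shift≢zero {r = free _}  ()
shift≢zero {r = bound _} ()

lift-injective : {f : Ref m → Ref n} → Injective _≡_ _≡_ f → Injective _≡_ _≡_ (lift f)
lift-injective inj {free x} {free y} e with inj (shift-injective e)
... | refl = refl
lift-injective inj {free x} {bound zero} e = ⊥-elim (shift≢zero e)
lift-injective inj {free x} {bound (suc j)} e with inj (shift-injective e)
... | ()
lift-injective inj {bound zero} {free y} e = ⊥-elim (shift≢zero (sym e))
lift-injective inj {bound zero} {bound zero} e = refl
lift-injective inj {bound zero} {bound (suc j)} e = ⊥-elim (shift≢zero (sym e))
lift-injective inj {bound (suc i)} {free y} e with inj (shift-injective e)
... | ()
lift-injective inj {bound (suc i)} {bound zero} e = ⊥-elim (shift≢zero e)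
lift-injective inj {bound (suc i)} {bound (suc j)} e with inj (shift-injective e)
... | refl = refl

lift≡shift : ∀ (f : Ref m → Ref n) r {s} → lift f r ≡ shift s →
             ∃ λ r′ → r ≡ shift r′ × f r′ ≡ s
lift≡shift f (free x)        e = free x , refl , shift-injective e
lift≡shift f (bound zero)    e = ⊥-elim (shift≢zero (sym e))
lift≡shift f (bound (suc i)) e = bound i , refl , shift-injective e

Reflects : (Ref m → Ref n) → Proc m → Offer n → Set
Reflects f P o = ∃ λ o′ → mapᵒ f o′ ≡ o × P ↓ o′

↓-unshift : ∀ (f : Ref m → Ref n) {P} o → Reflects (lift f) P (mapᵒ shift o) →
            Reflects f (ν P) o
↓-unshift f (receives x) (receives y , e , d) with lift≡shift f y (receives-injective e)
... | y′ , refl , refl = receives y′ , refl , ν d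
↓-unshift f (sends x) (sends y , e , d) with lift≡shift f y (sends-injective e)
... | y′ , refl , refl = sends y′ , refl , ν d
↓-unshift f internal (internal , e , d) = internal , refl , ν d

-- Injectivity matters for communications: channels that meet after renaming must already have been
-- equal before it.
↓-rename⁻ : {f : Ref m → Ref n} → Injective _≡_ _≡_ f → ∀ P {o} →
            rename f P ↓ o → Reflects f P o
↓-rename⁻ {f = f} inj (sum bs) (sum c∈ refl) with rename-∈⁻ f bs c∈
... | b , b∈ , refl = offerᵇ b , sym (offerᵇ-rename f b) , sum b∈ refl
↓-rename⁻ {f = f} inj (ν P) {o} (ν d) = ↓-unshift f o (↓-rename⁻ (lift-injective inj) P d)
↓-rename⁻ inj (P ∣ Q) (parˡ d) with ↓-rename⁻ inj P d
... | o′ , e , d′ = o′ , e , parˡ d′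
↓-rename⁻ inj (P ∣ Q) (parʳ d) with ↓-rename⁻ inj Q d
... | o′ , e , d′ = o′ , e , parʳ d′
↓-rename⁻ inj (P ∣ Q) (comˡ d e) with ↓-rename⁻ inj P d | ↓-rename⁻ inj Q e
... | receives x , refl , d′ | sends y , e″ , e′ with inj (sends-injective e″)
... | refl = internal , refl , comˡ d′ e′
↓-rename⁻ inj (P ∣ Q) (comʳ d e) with ↓-rename⁻ inj P d | ↓-rename⁻ inj Q e
... | sends x , refl , d′ | receives y , e″ , e′ with inj (receives-injective e″)
... | refl = internal , refl , comʳ d′ e′
↓-rename⁻ inj (! P) (rep d) with ↓-rename⁻ inj P d
... | o′ , e , d′ = o′ , e , rep d′
↓-rename⁻ inj (! P) (repcom d e) with ↓-rename⁻ inj P d | ↓-rename⁻ inj P e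
... | receives x , refl , d′ | sends y , e″ , e′ with inj (sends-injective e″)
... | refl = internal , refl , repcom d′ e′

↓-weaken⁻ : ∀ (P : Proc n) {o} → weaken P ↓ mapᵒ shift o → P ↓ o
↓-weaken⁻ P d with ↓-rename⁻ shift-injective P d
... | o′ , e , d′ = subst (P ↓_) (mapᵒ-injective shift-injective e) d′

-- A channel offered by `weaken Q` is a shifted one, so a communication with it does not use the
-- restricted name and survives when the restriction is moved back to `P`.
↓-extrude⁻ : ∀ {P : Proc (suc n)} {Q} o → P ∣ weaken Q ↓ mapᵒ shift o → ν P ∣ Q ↓ o
↓-extrude⁻         (receives _) (parˡ d) = parˡ (ν d)
↓-extrude⁻ {Q = Q} (receives _) (parʳ d) = parʳ (↓-weaken⁻ Q d)
↓-extrude⁻         (sends _)    (parˡ d) = parˡ (ν d)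
↓-extrude⁻ {Q = Q} (sends _)    (parʳ d) = parʳ (↓-weaken⁻ Q d)
↓-extrude⁻         internal     (parˡ d) = parˡ (ν d)
↓-extrude⁻ {Q = Q} internal     (parʳ d) = parʳ (↓-weaken⁻ Q d)
↓-extrude⁻ {Q = Q} internal     (comˡ d e) with ↓-rename⁻ shift-injective Q e
... | sends y , refl , e′ = comˡ (ν d) e′
↓-extrude⁻ {Q = Q} internal     (comʳ d e) with ↓-rename⁻ shift-injective Q e
... | receives y , refl , e′ = comʳ (ν d) e′

↓-summands : ∀ {bs cs : List (Branch n)} {o} → Pointwise _≅ᵇ_ bs cs →
             (sum bs ↓ o → sum cs ↓ o) × (sum cs ↓ o → sum bs ↓ o)
↓-summands es = (λ { (sum b∈ refl) → to es b∈ }) , (λ { (sum c∈ refl) → from es c∈ })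
  where
  offerᵇ-≅ : ∀ {b c : Branch n} → b ≅ᵇ c → offerᵇ b ≡ offerᵇ c
  offerᵇ-≅ (input _)  = refl
  offerᵇ-≅ (output _) = refl
  offerᵇ-≅ (silent _) = refl

  weaken-sum : ∀ {b : Branch n} {bs o} → sum bs ↓ o → sum (b ∷ bs) ↓ o
  weaken-sum (sum b∈ e) = sum (there b∈) e

  to : ∀ {b} {bs cs : List (Branch n)} → Pointwise _≅ᵇ_ bs cs → b ∈ bs → sum cs ↓ offerᵇ b
  to (e ∷ es) (here refl) = sum (here refl) (sym (offerᵇ-≅ e))
  to (e ∷ es) (there b∈)  = weaken-sum (to es b∈)

  from : ∀ {c} {bs cs : List (Branch n)} → Pointwise _≅ᵇ_ bs cs → c ∈ cs → sum bs ↓ offerᵇ c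
  from (e ∷ es) (here refl) = sum (here refl) (offerᵇ-≅ e)
  from (e ∷ es) (there c∈)  = weaken-sum (from es c∈)

↓-∣ : ∀ {P P′ Q Q′ : Proc n} {o} → (∀ {o} → P ↓ o → P′ ↓ o) → (∀ {o} → Q ↓ o → Q′ ↓ o) →
      P ∣ Q ↓ o → P′ ∣ Q′ ↓ o
↓-∣ f g (parˡ d)   = parˡ (f d)
↓-∣ f g (parʳ d)   = parʳ (g d)
↓-∣ f g (comˡ d e) = comˡ (f d) (g e)
↓-∣ f g (comʳ d e) = comʳ (f d) (g e)

↓-! : ∀ {P Q : Proc n} {o} → (∀ {o} → P ↓ o → Q ↓ o) → ! P ↓ o → ! Q ↓ o
↓-! f (rep d)      = rep (f d)
↓-! f (repcom d e) = repcom (f d) (f e)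

↓-≅ : ∀ {P Q : Proc n} {o} → P ≅ Q → (P ↓ o → Q ↓ o) × (Q ↓ o → P ↓ o)
↓-≅ {o = o} (extrude {P} {Q}) =
  (λ { (parˡ (ν d))   → ν (parˡ d)
     ; (parʳ d)       → ν (parʳ (↓-rename shift d))
     ; (comˡ (ν d) e) → ν (comˡ d (↓-rename shift e))
     ; (comʳ (ν d) e) → ν (comʳ d (↓-rename shift e)) }) ,
  (λ { (ν d) → ↓-extrude⁻ o d })
↓-≅ ≅-refl         = id , id
↓-≅ (≅-sym e)      = swap (↓-≅ e)
↓-≅ (≅-trans e e′) = proj₁ (↓-≅ e′) ∘ proj₁ (↓-≅ e) , proj₂ (↓-≅ e) ∘ proj₂ (↓-≅ e′)
↓-≅ (≅-sum es)     = ↓-summands es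
↓-≅ (≅-ν e)        = (λ { (ν d) → ν (proj₁ (↓-≅ e) d) }) , (λ { (ν d) → ν (proj₂ (↓-≅ e) d) })
↓-≅ (≅-∣ e e′)     = ↓-∣ (proj₁ (↓-≅ e)) (proj₁ (↓-≅ e′)) , ↓-∣ (proj₂ (↓-≅ e)) (proj₂ (↓-≅ e′))
↓-≅ (≅-! e)        = ↓-! (proj₁ (↓-≅ e)) , ↓-! (proj₂ (↓-≅ e))

↓-rep⁻ : ∀ {P : Proc n} {o} → P ∣ ! P ↓ o → ! P ↓ o
↓-rep⁻ (parˡ d)         = rep d
↓-rep⁻ (parʳ d)         = d
↓-rep⁻ (comˡ d (rep e)) = repcom d e
↓-rep⁻ (comʳ d (rep e)) = repcom e d

offerᵃ : Action → Offer 0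
offerᵃ (recv x _)  = receives (free x)
offerᵃ (send x _)  = sends (free x)
offerᵃ (sendν x _) = sends (free x)
offerᵃ τ           = internal

↓-ν : ∀ {P k} μ → chan k ∉ names μ → P ↓ offerᵃ μ → ν⟨ k ⟩ P ↓ offerᵃ μ
↓-ν {P} {k} μ k∉ d = ν (subst (_ ↓_) (unbound μ k∉) (↓-rename (bindʳ (chan k)) d))
  where
  unbound : ∀ μ → chan k ∉ names μ → mapᵒ (bindʳ (chan k)) (offerᵃ μ) ≡ mapᵒ shift (offerᵃ μ)
  unbound (recv x _)  k∉ = cong receives (bindʳ-≢ (λ { refl → k∉ (here refl) }))
  unbound (send x _)  k∉ = cong sends (bindʳ-≢ (λ { refl → k∉ (here refl) }))
  unbound (sendν x _) k∉ = cong sends (bindʳ-≢ (λ { refl → k∉ (here refl) }))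
  unbound τ           k∉ = refl

-- Used contrapositively: a process that lacks the relevant offers is final, whatever use of
-- structural congruence a derivation might make.
transition⇒↓ : ∀ {P P′ μ} → P —[ μ ]→ P′ → P ↓ offerᵃ μ
transition⇒↓ (i-sum y b∈)     = sum b∈ refl
transition⇒↓ (o-sum b∈)       = sum b∈ refl
transition⇒↓ (τ-sum b∈)       = sum b∈ refl
transition⇒↓ (opening {P = P} {k = k} t x≢k) =
  ν (subst (rename (bindʳ (chan k)) P ↓_) (cong sends (bindʳ-≢ x≢k))
       (↓-rename (bindʳ (chan k)) (transition⇒↓ t)))
transition⇒↓ (res {μ = μ} t k∉) = ↓-ν μ k∉ (transition⇒↓ t)
transition⇒↓ (parˡ t _)       = parˡ (transition⇒↓ t)
transition⇒↓ (parʳ t _)       = parʳ (transition⇒↓ t)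
transition⇒↓ (comˡ t u)       = comˡ (transition⇒↓ t) (transition⇒↓ u)
transition⇒↓ (comʳ t u)       = comʳ (transition⇒↓ t) (transition⇒↓ u)
transition⇒↓ (closeˡ t u _)   = comˡ (transition⇒↓ t) (transition⇒↓ u)
transition⇒↓ (closeʳ t u _)   = comʳ (transition⇒↓ t) (transition⇒↓ u)
transition⇒↓ (rep t)          = ↓-rep⁻ (transition⇒↓ t)
transition⇒↓ (struct e t _)   = proj₂ (↓-≅ e) (transition⇒↓ t)

-- Decidability of offers

subjectsᵒ : Offer n → List Name
subjectsᵒ (receives x) = fnʳ x
subjectsᵒ (sends x)    = fnʳ x
subjectsᵒ internal     = []

subjectsᵒ-shift : ∀ (o : Offer n) {x} → x ∈ subjectsᵒ o → x ∈ subjectsᵒ (mapᵒ shift o)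
subjectsᵒ-shift (receives (free _)) x∈ = x∈
subjectsᵒ-shift (sends (free _))    x∈ = x∈

↓-fn : ∀ {P : Proc n} {o x} → P ↓ o → x ∈ subjectsᵒ o → x ∈ fn P
↓-fn (sum {b = b} b∈ refl) = fn-branch b∈ ∘ fn-subject b
  where
  fn-subject : ∀ (b : Branch n) {x} → x ∈ subjectsᵒ (offerᵇ b) → x ∈ fnᵇ b
  fn-subject (input _ _)    = ∈-++⁺ˡ
  fn-subject (output _ _ _) = ∈-++⁺ˡ
↓-fn (ν {o = o} d)    = ↓-fn d ∘ subjectsᵒ-shift o
↓-fn (parˡ d)         = ∈-++⁺ˡ ∘ ↓-fn d
↓-fn (parʳ {P = P} d) = ∈-++⁺ʳ (fn P) ∘ ↓-fn d
↓-fn (rep d)          = ↓-fn d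

-- The search is finite: there are finitely many indices, and the names that satisfy `A` lie in the
-- given list.
any-ref? : {A : Ref n → Set} → (∀ r → Dec (A r)) → ∀ xs →
           (∀ {x} → A (free x) → x ∈ xs) → Dec (∃ A)
any-ref? A? xs A⊆xs =
  map′ [ (λ { (i , a) → bound i , a }) , (λ a → let x , _ , a′ = find a in free x , a′) ]′
       (λ { (bound i , a) → inj₁ (i , a) ; (free x , a) → inj₂ (lose (A⊆xs a) a) })
       (Fin.any? (A? ∘ bound) ⊎-dec Any.any? (A? ∘ free) xs)

infix 4 _≟ʳ_ _≟ᵒ_

_≟ʳ_ : DecidableEquality (Ref n)
free x  ≟ʳ free y  = map′ (cong free) (λ { refl → refl }) (x ≟ y)
free _  ≟ʳ bound _ = no λ ()
bound _ ≟ʳ free _  = no λ ()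
bound i ≟ʳ bound j = map′ (cong bound) (λ { refl → refl }) (i Fin.≟ j)

_≟ᵒ_ : DecidableEquality (Offer n)
receives x ≟ᵒ receives y = map′ (cong receives) receives-injective (x ≟ʳ y)
receives _ ≟ᵒ sends _    = no λ ()
receives _ ≟ᵒ internal   = no λ ()
sends _    ≟ᵒ receives _ = no λ ()
sends x    ≟ᵒ sends y    = map′ (cong sends) sends-injective (x ≟ʳ y)
sends _    ≟ᵒ internal   = no λ ()
internal   ≟ᵒ receives _ = no λ ()
internal   ≟ᵒ sends _    = no λ ()
internal   ≟ᵒ internal   = yes refl

infix 4 _↓?_

-- Only `internal` needs the search for a channel shared by two components.
mutual

  _↓?_ : ∀ (P : Proc n) o → Dec (P ↓ o)
  sum bs ↓? o =
    map′ (λ b∈ → let _ , b∈bs , e = find b∈ in sum b∈bs e) (λ { (sum b∈ e) → lose b∈ e })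
         (Any.any? (λ b → offerᵇ b ≟ᵒ o) bs)
  ν P ↓? o = map′ ν (λ { (ν d) → d }) (P ↓? mapᵒ shift o)
  (P ∣ Q) ↓? receives x =
    map′ [ parˡ , parʳ ]′ (λ { (parˡ d) → inj₁ d ; (parʳ d) → inj₂ d })
         ((P ↓? receives x) ⊎-dec (Q ↓? receives x))
  (P ∣ Q) ↓? sends x =
    map′ [ parˡ , parʳ ]′ (λ { (parˡ d) → inj₁ d ; (parʳ d) → inj₂ d })
         ((P ↓? sends x) ⊎-dec (Q ↓? sends x))
  (P ∣ Q) ↓? internal =
    map′ [ [ parˡ , parʳ ]′ , [ (λ (_ , d , e) → comˡ d e) , (λ (_ , d , e) → comʳ e d) ]′ ]′
         (λ { (parˡ d) → inj₁ (inj₁ d) ; (parʳ d) → inj₁ (inj₂ d)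
            ; (comˡ d e) → inj₂ (inj₁ (_ , d , e)) ; (comʳ d e) → inj₂ (inj₂ (_ , e , d)) })
         (((P ↓? internal) ⊎-dec (Q ↓? internal)) ⊎-dec (common? P Q ⊎-dec common? Q P))
  (! P) ↓? receives x = map′ rep (λ { (rep d) → d }) (P ↓? receives x)
  (! P) ↓? sends x    = map′ rep (λ { (rep d) → d }) (P ↓? sends x)
  (! P) ↓? internal =
    map′ [ rep , (λ (_ , d , e) → repcom d e) ]′
         (λ { (rep d) → inj₁ d ; (repcom d e) → inj₂ (_ , d , e) })
         ((P ↓? internal) ⊎-dec common? P P)

  common? : ∀ (P Q : Proc n) → Dec (∃ λ x → P ↓ receives x × Q ↓ sends x)
  common? P Q = any-ref? (λ x → (P ↓? receives x) ×-dec (Q ↓? sends x)) (fn P)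
                         (λ (d , _) → ↓-fn d (here refl))

-- Transitions on terms with dangling indices

-- `true ⊕ n` indices dangle after an action that binds a name.
_⊕_ : Bool → ℕ → ℕ
false ⊕ n = n
true  ⊕ n = suc n

data Act (n : ℕ) : Bool → Set where
  τ       : Act n false
  output  : Ref n → Ref n → Act n false
  outputν : Ref n → Act n true
  input   : Ref n → Act n true

mapᵃ : (Ref m → Ref n) → Act m d → Act n d
mapᵃ f τ            = τ
mapᵃ f (output x y) = output (f x) (f y)
mapᵃ f (outputν x)  = outputν (f x)
mapᵃ f (input x)    = input (f x)

mapᵃ-square : ∀ {k} {f : Ref k → Ref l} {g : Ref l → Ref n}
              {f′ : Ref k → Ref m} {g′ : Ref m → Ref n} →
              g ∘ f ≗ g′ ∘ f′ → (a : Act k d) → mapᵃ g (mapᵃ f a) ≡ mapᵃ g′ (mapᵃ f′ a)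
mapᵃ-square e τ            = refl
mapᵃ-square e (output x y) = cong₂ output (e x) (e y)
mapᵃ-square e (outputν x)  = cong outputν (e x)
mapᵃ-square e (input x)    = cong input (e x)

offer : Act n d → Offer n
offer τ            = internal
offer (output x _) = sends x
offer (outputν x)  = sends x
offer (input x)    = receives x

lift⊕ : ∀ d → (Ref m → Ref n) → Ref (d ⊕ m) → Ref (d ⊕ n)
lift⊕ false f = f
lift⊕ true  f = lift f

weaken⊕ : ∀ d → Proc n → Proc (d ⊕ n)
weaken⊕ false P = P
weaken⊕ true  P = weaken P

swapʳ : Ref (suc (suc n)) → Ref (suc (suc n))
swapʳ (bound zero)       = bound (suc zero)
swapʳ (bound (suc zero)) = bound zero
swapʳ r                  = r

-- After a binding action under a restriction, index zero is the name bound by the action and index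
-- one the restricted name. They trade places before the restriction is put back.
exchange : ∀ d → Proc (d ⊕ suc n) → Proc (suc (d ⊕ n))
exchange false P = P
exchange true  P = rename swapʳ P

inst : Ref n → Ref (suc n) → Ref n
inst y (free x)        = free x
inst y (bound zero)    = y
inst y (bound (suc i)) = bound i

infix 9 _⟨_⟩

_⟨_⟩ : Proc (suc n) → Ref n → Proc n
P ⟨ y ⟩ = rename (inst y) P

infix 4 _—⟨_⟩→_

-- A late semantics: an input leaves the received name as a dangling index, which a communication
-- instantiates. Indices replace all freshness conditions, and there is no rule for structural
-- congruence. It serves to construct computations, which `sound` carries over to `_—[_]→_`.
data _—⟨_⟩→_ {n : ℕ} : Proc n → Act n d → Proc (d ⊕ n) → Set where
  input  : ∀ {bs x P} → input x P ∈ bs → sum bs —⟨ input x ⟩→ P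
  output : ∀ {bs x y P} → output x y P ∈ bs → sum bs —⟨ output x y ⟩→ P
  silent : ∀ {bs P} → silent P ∈ bs → sum bs —⟨ τ ⟩→ P
  opening : ∀ {P P′ x} → P —⟨ output (shift x) (bound zero) ⟩→ P′ → ν P —⟨ outputν x ⟩→ P′
  ν      : ∀ {d} {a : Act n d} {P P′} → P —⟨ mapᵃ shift a ⟩→ P′ → ν P —⟨ a ⟩→ ν (exchange d P′)
  parˡ   : ∀ {d} {a : Act n d} {P P′ Q} → P —⟨ a ⟩→ P′ → P ∣ Q —⟨ a ⟩→ P′ ∣ weaken⊕ d Q
  parʳ   : ∀ {d} {a : Act n d} {P Q Q′} → Q —⟨ a ⟩→ Q′ → P ∣ Q —⟨ a ⟩→ weaken⊕ d P ∣ Q′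
  comˡ   : ∀ {P P′ Q Q′ x y} → P —⟨ input x ⟩→ P′ → Q —⟨ output x y ⟩→ Q′ →
           P ∣ Q —⟨ τ ⟩→ P′ ⟨ y ⟩ ∣ Q′
  comʳ   : ∀ {P P′ Q Q′ x y} → P —⟨ output x y ⟩→ P′ → Q —⟨ input x ⟩→ Q′ →
           P ∣ Q —⟨ τ ⟩→ P′ ∣ Q′ ⟨ y ⟩
  closeˡ : ∀ {P P′ Q Q′ x} → P —⟨ input x ⟩→ P′ → Q —⟨ outputν x ⟩→ Q′ →
           P ∣ Q —⟨ τ ⟩→ ν (P′ ∣ Q′)
  closeʳ : ∀ {P P′ Q Q′ x} → P —⟨ outputν x ⟩→ P′ → Q —⟨ input x ⟩→ Q′ →
           P ∣ Q —⟨ τ ⟩→ ν (P′ ∣ Q′)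
  rep    : ∀ {d} {a : Act n d} {P P′} → P ∣ ! P —⟨ a ⟩→ P′ → ! P —⟨ a ⟩→ P′

-- Transitions under renaming

swapʳ-shift² : (r : Ref n) → swapʳ (shift (shift r)) ≡ shift (shift r)
swapʳ-shift² (free _)  = refl
swapʳ-shift² (bound _) = refl

swapʳ-lift : (f : Ref m → Ref n) → lift (lift f) ∘ swapʳ ≗ swapʳ ∘ lift (lift f)
swapʳ-lift f (free x)              = sym (swapʳ-shift² (f (free x)))
swapʳ-lift f (bound zero)          = refl
swapʳ-lift f (bound (suc zero))    = refl
swapʳ-lift f (bound (suc (suc i))) = sym (swapʳ-shift² (f (bound i)))

inst-shift : (y : Ref n) → inst y ∘ shift ≗ id
inst-shift y (free _)  = refl
inst-shift y (bound _) = refl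

inst-lift : (f : Ref m → Ref n) (y : Ref m) → f ∘ inst y ≗ inst (f y) ∘ lift f
inst-lift f y (free x)        = sym (inst-shift (f y) (f (free x)))
inst-lift f y (bound zero)    = refl
inst-lift f y (bound (suc i)) = sym (inst-shift (f y) (f (bound i)))

rename-exchange : ∀ d (f : Ref m → Ref n) P →
                  rename (lift (lift⊕ d f)) (exchange d P) ≡ exchange d (rename (lift⊕ d (lift f)) P)
rename-exchange false f P = refl
rename-exchange true  f P = rename-square (swapʳ-lift f) P

rename-weaken⊕ : ∀ d (f : Ref m → Ref n) P →
                 rename (lift⊕ d f) (weaken⊕ d P) ≡ weaken⊕ d (rename f P)
rename-weaken⊕ false f P = refl
rename-weaken⊕ true  f P = rename-square (lift-shift f) P

rename-⟨⟩ : ∀ (f : Ref m → Ref n) y P → rename f (P ⟨ y ⟩) ≡ rename (lift f) P ⟨ f y ⟩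
rename-⟨⟩ f y P = rename-square (inst-lift f y) P

to-target : ∀ {a : Act n d} {P P′ Q′} → P′ ≡ Q′ → P —⟨ a ⟩→ P′ → P —⟨ a ⟩→ Q′
to-target refl t = t

by-action : ∀ {a b : Act n d} {P P′} → a ≡ b → P —⟨ a ⟩→ P′ → P —⟨ b ⟩→ P′
by-action refl t = t

-- Holds for arbitrary renamings, since no rule has a freshness condition. It is applied both to the
-- mirror symmetry and to the instantiation of a received name.
rename-→ : (f : Ref m → Ref n) → ∀ {d} {a : Act m d} {P P′} →
           P —⟨ a ⟩→ P′ → rename f P —⟨ mapᵃ f a ⟩→ rename (lift⊕ d f) P′
rename-→ f (input b∈)  = input (rename-∈ f b∈)
rename-→ f (output b∈) = output (rename-∈ f b∈)
rename-→ f (silent b∈) = silent (rename-∈ f b∈)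
rename-→ f (opening {x = x} t) =
  opening (by-action (cong (λ z → output z (bound zero)) (lift-shift f x)) (rename-→ (lift f) t))
rename-→ f (ν {d = d} {a = a} {P′ = P′} t) =
  to-target (cong ν (sym (rename-exchange d f P′)))
            (ν (by-action (mapᵃ-square (lift-shift f) a) (rename-→ (lift f) t)))
rename-→ f (parˡ {d = d} {Q = Q} t) =
  to-target (cong (_ ∣_) (sym (rename-weaken⊕ d f Q))) (parˡ (rename-→ f t))
rename-→ f (parʳ {d = d} {P = P} t) =
  to-target (cong (_∣ _) (sym (rename-weaken⊕ d f P))) (parʳ (rename-→ f t))
rename-→ f (comˡ {P′ = P′} {y = y} t u) =
  to-target (cong (_∣ _) (sym (rename-⟨⟩ f y P′))) (comˡ (rename-→ f t) (rename-→ f u))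
rename-→ f (comʳ {Q′ = Q′} {y = y} t u) =
  to-target (cong (_ ∣_) (sym (rename-⟨⟩ f y Q′))) (comʳ (rename-→ f t) (rename-→ f u))
rename-→ f (closeˡ t u) = closeˡ (rename-→ f t) (rename-→ f u)
rename-→ f (closeʳ t u) = closeʳ (rename-→ f t) (rename-→ f u)
rename-→ f (rep t)      = rep (rename-→ f t)

→⇒↓ : ∀ {a : Act n d} {P P′} → P —⟨ a ⟩→ P′ → P ↓ offer a
→⇒↓ (input b∈)   = sum b∈ refl
→⇒↓ (output b∈)  = sum b∈ refl
→⇒↓ (silent b∈)  = sum b∈ refl
→⇒↓ (opening t)  = ν (→⇒↓ t)
→⇒↓ (ν {a = a} t) = ν (subst (_ ↓_) (offer-shift a) (→⇒↓ t))
  where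
  offer-shift : (a : Act n d) → offer (mapᵃ shift a) ≡ mapᵒ shift (offer a)
  offer-shift τ            = refl
  offer-shift (output _ _) = refl
  offer-shift (outputν _)  = refl
  offer-shift (input _)    = refl
→⇒↓ (parˡ t)     = parˡ (→⇒↓ t)
→⇒↓ (parʳ t)     = parʳ (→⇒↓ t)
→⇒↓ (comˡ t u)   = comˡ (→⇒↓ t) (→⇒↓ u)
→⇒↓ (comʳ t u)   = comʳ (→⇒↓ t) (→⇒↓ u)
→⇒↓ (closeˡ t u) = comˡ (→⇒↓ t) (→⇒↓ u)
→⇒↓ (closeʳ t u) = comʳ (→⇒↓ t) (→⇒↓ u)
→⇒↓ (rep t)      = ↓-rep⁻ (→⇒↓ t)

-- Soundness

Env : ℕ → Set
Env n = Ref n → Name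

infixl 9 _▸_

_▸_ : Env n → Name → Env (suc n)
(ρ ▸ y) (free x)        = ρ (free x)
(ρ ▸ y) (bound zero)    = y
(ρ ▸ y) (bound (suc i)) = ρ (bound i)

infixr 7 _⋆_

_⋆_ : Env n → Proc n → Process
ρ ⋆ P = rename (free ∘ ρ) P

▸-lift : (ρ : Env n) (y : Name) → free ∘ (ρ ▸ y) ≗ instʳ y ∘ lift (free ∘ ρ)
▸-lift ρ y (free x)        = refl
▸-lift ρ y (bound zero)    = refl
▸-lift ρ y (bound (suc i)) = refl

▸-shift : (ρ : Env n) (y : Name) → (ρ ▸ y) ∘ shift ≗ ρ
▸-shift ρ y (free x)  = refl
▸-shift ρ y (bound i) = refl

▸-swap : (ρ : Env n) (y z : Name) → (ρ ▸ y ▸ z) ∘ swapʳ ≗ ρ ▸ z ▸ y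
▸-swap ρ y z (free x)              = refl
▸-swap ρ y z (bound zero)          = refl
▸-swap ρ y z (bound (suc zero))    = refl
▸-swap ρ y z (bound (suc (suc i))) = refl

⋆-▸ : (ρ : Env n) (y : Name) → ∀ P → (ρ ▸ y) ⋆ P ≡ rename (lift (free ∘ ρ)) P [ y ]
⋆-▸ ρ y P = sym (rename-∘ (sym ∘ ▸-lift ρ y) P)

⋆-weaken : (ρ : Env n) (y : Name) → ∀ P → (ρ ▸ y) ⋆ weaken P ≡ ρ ⋆ P
⋆-weaken ρ y P = rename-∘ (cong free ∘ ▸-shift ρ y) P

⋆-⟨⟩ : (ρ : Env n) (y : Ref n) → ∀ P → (ρ ▸ ρ y) ⋆ P ≡ ρ ⋆ P ⟨ y ⟩
⋆-⟨⟩ ρ y P = sym (rename-∘ (λ { (free _) → refl ; (bound zero) → refl ; (bound (suc _)) → refl }) P)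

-- `ν⟨ k ⟩` binds again the name just put in for index zero; as `chan k` is fresh, nothing else is
-- captured.
⋆-ν : (ρ : Env n) → ∀ {k} P → chan k ∉ fn (ρ ⋆ ν P) → ν⟨ k ⟩ (ρ ▸ chan k) ⋆ P ≡ ρ ⋆ ν P
⋆-ν ρ {k} P k∉ rewrite ⋆-▸ ρ (chan k) P =
  cong ν (trans (rename-∘ (λ _ → refl) Pᵨ)
                (trans (rename-agree Pᵨ (agree (λ { zero → bindʳ-≡ (chan k) })
                                               (λ x∈ → bindʳ-≢ (λ { refl → k∉ x∈ }))))
                       (rename-id (λ _ → refl) Pᵨ)))
  where
  Pᵨ = rename (lift (free ∘ ρ)) P

-- A strict bound on the ordinary names in the list, whence the `suc`; the bound is then itself the
-- index of a fresh name.
chanBound : List Name → ℕ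
chanBound []            = 0
chanBound (chan k ∷ xs) = suc k ⊔ chanBound xs
chanBound (_ ∷ xs)      = chanBound xs

chanBound-∉ : ∀ xs {k} → chanBound xs ≤ k → chan k ∉ xs
chanBound-∉ (chan l ∷ xs) l<k (here refl) =
  ℕₚ.<-irrefl refl (ℕₚ.m⊔n≤o⇒m≤o (suc l) (chanBound xs) l<k)
chanBound-∉ (chan l ∷ xs) xs≤k (there k∈) =
  chanBound-∉ xs (ℕₚ.m⊔n≤o⇒n≤o (suc l) (chanBound xs) xs≤k) k∈
chanBound-∉ (ident _ ∷ xs) xs≤k (there k∈) = chanBound-∉ xs xs≤k k∈
chanBound-∉ (out ∷ xs) xs≤k (there k∈) = chanBound-∉ xs xs≤k k∈

fresh : ∀ xs → ∃ λ k → chan k ∉ xs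
fresh xs = chanBound xs , chanBound-∉ xs ℕₚ.≤-refl

-- A binding action stands for a family of named actions: one for each name received, or one for
-- each ordinary name not free in the source. The whole family is kept so that the induction can
-- choose the name at a `closeˡ` or `closeʳ`.
Realises : Env n → Act n d → Process → Proc (d ⊕ n) → Set
Realises ρ τ            R P′ = R —[ τ ]→ ρ ⋆ P′
Realises ρ (output x y) R P′ = R —[ send (ρ x) (ρ y) ]→ ρ ⋆ P′
Realises ρ (outputν x)  R P′ = ∀ k → chan k ∉ fn R → R —[ sendν (ρ x) k ]→ (ρ ▸ chan k) ⋆ P′
Realises ρ (input x)    R P′ = ∀ y → R —[ recv (ρ x) y ]→ (ρ ▸ y) ⋆ P′

rewrite-→ : ∀ {P P′ Q Q′ μ} → P ≡ P′ → Q ≡ Q′ → P —[ μ ]→ Q → P′ —[ μ ]→ Q′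
rewrite-→ refl refl t = t

retarget : ∀ {P Q Q′ μ} → Q ≡ Q′ → P —[ μ ]→ Q → P —[ μ ]→ Q′
retarget = rewrite-→ refl

relabel : ∀ {P Q μ μ′} → μ ≡ μ′ → P —[ μ ]→ Q → P —[ μ′ ]→ Q
relabel refl t = t

res-⋆ : ∀ {ρ : Env m} {ρ′ : Env n} {k μ} P P′ →
        chan k ∉ fn (ρ ⋆ ν P) ++ fn (ρ′ ⋆ ν P′) ++ names μ →
        (ρ ▸ chan k) ⋆ P —[ μ ]→ (ρ′ ▸ chan k) ⋆ P′ → ρ ⋆ ν P —[ μ ]→ ρ′ ⋆ ν P′
res-⋆ {ρ = ρ} {ρ′} P P′ k∉ t =
  rewrite-→ (⋆-ν ρ P (k∉ ∘ ∈-++⁺ˡ)) (⋆-ν ρ′ P′ (k∉ ∘ ∈-++⁺ʳ (fn (ρ ⋆ ν P)) ∘ ∈-++⁺ˡ))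
            (res t (k∉ ∘ ∈-++⁺ʳ (fn (ρ ⋆ ν P)) ∘ ∈-++⁺ʳ (fn (ρ′ ⋆ ν P′))))

-- The restricted name is instantiated by a fresh `chan k`, `res` is applied, and `chan k` is bound
-- again. The premise covers every `k` because the choice has to avoid the received or extruded name
-- too.
ν-sound : ∀ (ρ : Env n) (a : Act n d) P P′ →
          (∀ k → Realises (ρ ▸ chan k) (mapᵃ shift a) ((ρ ▸ chan k) ⋆ P) P′) →
          Realises ρ a (ρ ⋆ ν P) (ν (exchange d P′))
ν-sound ρ τ P P′ t with fresh (fn (ρ ⋆ ν P) ++ fn (ρ ⋆ ν P′) ++ [])
... | k , k∉ = res-⋆ P P′ k∉ (t k)
ν-sound ρ (output x y) P P′ t
  with fresh (fn (ρ ⋆ ν P) ++ fn (ρ ⋆ ν P′) ++ ρ x ∷ ρ y ∷ [])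
... | k , k∉ = res-⋆ P P′ k∉
  (relabel (cong₂ send (▸-shift ρ (chan k) x) (▸-shift ρ (chan k) y)) (t k))
ν-sound ρ (input x) P P′ t y
  with fresh (fn (ρ ⋆ ν P) ++ fn ((ρ ▸ y) ⋆ ν (exchange true P′)) ++ ρ x ∷ y ∷ [])
... | k , k∉ = res-⋆ P (exchange true P′) k∉
  (retarget (sym (rename-∘ (cong free ∘ ▸-swap ρ y (chan k)) P′))
    (relabel (cong (λ z → recv z y) (▸-shift ρ (chan k) x)) (t k y)))
ν-sound ρ (outputν x) P P′ t j j∉
  with fresh (fn (ρ ⋆ ν P) ++ fn ((ρ ▸ chan j) ⋆ ν (exchange true P′)) ++ ρ x ∷ chan j ∷ [])
... | k , k∉ = res-⋆ P (exchange true P′) k∉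
  (retarget (sym (rename-∘ (cong free ∘ ▸-swap ρ (chan j) (chan k)) P′))
    (relabel (cong (λ z → sendν z j) (▸-shift ρ (chan k) x)) (t k j j∉P)))
  where
  j≢k : chan j ≢ chan k
  j≢k refl = k∉ (∈-++⁺ʳ (fn (ρ ⋆ ν P))
                  (∈-++⁺ʳ (fn ((ρ ▸ chan j) ⋆ ν (exchange true P′))) (there (here refl))))
  -- Instantiating index zero adds at most `chan k` to the free names, and `chan j` differs from it.
  j∉P : chan j ∉ fn ((ρ ▸ chan k) ⋆ P)
  j∉P = j∉ ∘ fn-[]⁻ (rename (lift (free ∘ ρ)) P) j≢k
           ∘ subst (λ R → chan j ∈ fn R) (⋆-▸ ρ (chan k) P)

parˡ-sound : ∀ (ρ : Env n) (a : Act n d) {P P′ Q} →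
             Realises ρ a (ρ ⋆ P) P′ → Realises ρ a (ρ ⋆ (P ∣ Q)) (P′ ∣ weaken⊕ d Q)
parˡ-sound ρ τ            t = parˡ t λ ()
parˡ-sound ρ (output x y) t = parˡ t λ ()
parˡ-sound ρ (input x)    {Q = Q} t y =
  retarget (cong (_ ∣_) (sym (⋆-weaken ρ y Q))) (parˡ (t y) λ ())
parˡ-sound ρ (outputν x) {P} {Q = Q} t k k∉ =
  retarget (cong (_ ∣_) (sym (⋆-weaken ρ (chan k) Q)))
    (parˡ (t k (k∉ ∘ ∈-++⁺ˡ)) (λ { (here refl , k∈) → k∉ (∈-++⁺ʳ (fn (ρ ⋆ P)) k∈) }))

parʳ-sound : ∀ (ρ : Env n) (a : Act n d) {P Q Q′} →
             Realises ρ a (ρ ⋆ Q) Q′ → Realises ρ a (ρ ⋆ (P ∣ Q)) (weaken⊕ d P ∣ Q′)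
parʳ-sound ρ τ            t = parʳ t λ ()
parʳ-sound ρ (output x y) t = parʳ t λ ()
parʳ-sound ρ (input x)    {P} t y =
  retarget (cong (_∣ _) (sym (⋆-weaken ρ y P))) (parʳ (t y) λ ())
parʳ-sound ρ (outputν x) {P} t k k∉ =
  retarget (cong (_∣ _) (sym (⋆-weaken ρ (chan k) P)))
    (parʳ (t k (k∉ ∘ ∈-++⁺ʳ (fn (ρ ⋆ P)))) (λ { (here refl , k∈) → k∉ (∈-++⁺ˡ k∈) }))

rep-sound : ∀ (ρ : Env n) (a : Act n d) {P P′} →
            Realises ρ a (ρ ⋆ (P ∣ ! P)) P′ → Realises ρ a (ρ ⋆ ! P) P′
rep-sound ρ τ            t = rep t
rep-sound ρ (output x y) t = rep t
rep-sound ρ (input x)    t y = rep (t y)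
rep-sound ρ (outputν x)  t k k∉ = rep (t k (∈-++-case k∉ k∉))

sound : ∀ {a : Act n d} {P P′} → P —⟨ a ⟩→ P′ → ∀ ρ → Realises ρ a (ρ ⋆ P) P′
sound (input {P = P} b∈) ρ y =
  retarget (sym (⋆-▸ ρ y P)) (i-sum y (rename-∈ (free ∘ ρ) b∈))
sound (output b∈) ρ = o-sum (rename-∈ (free ∘ ρ) b∈)
sound (silent b∈) ρ = τ-sum (rename-∈ (free ∘ ρ) b∈)
sound (opening {P} {P′} {x} t) ρ k k∉ =
  rewrite-→ (⋆-ν ρ P k∉) refl
    (opening (relabel (cong (λ z → send z (chan k)) (▸-shift ρ (chan k) x)) (sound t (ρ ▸ chan k)))
             -- The subject is free in the source, because an output on it is offered there; hence
             -- it is not the fresh name.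
             (λ ρx≡k → k∉ (subst (_∈ fn (ρ ⋆ ν P)) ρx≡k
                             (↓-fn (↓-rename (free ∘ ρ) (ν (→⇒↓ t))) (here refl)))))
sound (ν {a = a} {P} {P′} t) ρ = ν-sound ρ a P P′ (λ k → sound t (ρ ▸ chan k))
sound (parˡ {a = a} t) ρ = parˡ-sound ρ a (sound t ρ)
sound (parʳ {a = a} t) ρ = parʳ-sound ρ a (sound t ρ)
sound (comˡ {P′ = P′} {y = y} t u) ρ =
  retarget (cong (_∣ _) (⋆-⟨⟩ ρ y P′)) (comˡ (sound t ρ (ρ y)) (sound u ρ))
sound (comʳ {Q′ = Q′} {y = y} t u) ρ =
  retarget (cong (_ ∣_) (⋆-⟨⟩ ρ y Q′)) (comʳ (sound t ρ) (sound u ρ (ρ y)))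
sound (closeˡ {P} {P′} {Q} {Q′} t u) ρ with fresh (fn (ρ ⋆ (P ∣ Q)) ++ fn (ρ ⋆ ν (P′ ∣ Q′)))
... | k , k∉ =
  retarget (⋆-ν ρ (P′ ∣ Q′) (k∉ ∘ ∈-++⁺ʳ (fn (ρ ⋆ (P ∣ Q)))))
    (closeˡ (sound t ρ (chan k)) (sound u ρ k (k∉ ∘ ∈-++⁺ˡ ∘ ∈-++⁺ʳ (fn (ρ ⋆ P))))
            (k∉ ∘ ∈-++⁺ˡ ∘ ∈-++⁺ˡ))
sound (closeʳ {P} {P′} {Q} {Q′} t u) ρ with fresh (fn (ρ ⋆ (P ∣ Q)) ++ fn (ρ ⋆ ν (P′ ∣ Q′)))
... | k , k∉ =
  retarget (⋆-ν ρ (P′ ∣ Q′) (k∉ ∘ ∈-++⁺ʳ (fn (ρ ⋆ (P ∣ Q)))))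
    (closeʳ (sound t ρ k (k∉ ∘ ∈-++⁺ˡ ∘ ∈-++⁺ˡ)) (sound u ρ (chan k))
            (k∉ ∘ ∈-++⁺ˡ ∘ ∈-++⁺ʳ (fn (ρ ⋆ P))))
sound (rep {a = a} t) ρ = rep-sound ρ a (sound t ρ)

-- Offers are realised by transitions

data OutputOn {n : ℕ} (x : Ref n) : Act n d → Set where
  output  : ∀ {y} → OutputOn x (output x y)
  outputν : OutputOn x (outputν x)

-- An offer to send does not tell a free output from a bound one, so the kind of output is part of
-- the witness.
record Emission (P : Proc n) (x : Ref n) : Set where
  constructor emission
  field
    {binds}  : Bool
    {action} : Act n binds
    {target} : Proc (binds ⊕ n)
    kind     : OutputOn x action
    step     : P —⟨ action ⟩→ target

receive : ∀ {P : Proc n} {x} → P ↓ receives x → ∃ λ P′ → P —⟨ input x ⟩→ P′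
receive (sum {b = input _ _} b∈ refl) = _ , input b∈
receive (ν d) with receive d
... | _ , t = _ , ν t
receive (parˡ d) with receive d
... | _ , t = _ , parˡ t
receive (parʳ d) with receive d
... | _ , t = _ , parʳ t
receive (rep d) with receive d
... | _ , t = _ , rep (parˡ t)

emit : ∀ {P : Proc n} {x} → P ↓ sends x → Emission P x
emit (sum {b = output _ _ _} b∈ refl) = emission output (output b∈)
emit (ν d) with emit d
... | emission (output {free y}) t        = emission output (ν {a = output _ (free y)} t)
-- The object is the very name restricted here, so the output extrudes it.
... | emission (output {bound zero}) t    = emission outputν (opening t)
... | emission (output {bound (suc i)}) t = emission output (ν {a = output _ (bound i)} t)
... | emission outputν t                  = emission outputν (ν t)
emit (parˡ d) with emit d
... | emission k t = emission k (parˡ t)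
emit (parʳ d) with emit d
... | emission k t = emission k (parʳ t)
emit (rep d) with emit d
... | emission k t = emission k (rep (parˡ t))

communicate : ∀ {P Q : Proc n} {x} → P ↓ receives x → Q ↓ sends x →
              (∃ λ R → P ∣ Q —⟨ τ ⟩→ R) × (∃ λ R → Q ∣ P —⟨ τ ⟩→ R)
communicate d e with receive d | emit e
... | _ , t | emission output u  = (_ , comˡ t u) , (_ , comʳ u t)
... | _ , t | emission outputν u = (_ , closeˡ t u) , (_ , closeʳ u t)

react : ∀ {P : Proc n} → P ↓ internal → ∃ λ P′ → P —⟨ τ ⟩→ P′
react (sum {b = silent _} b∈ refl) = _ , silent b∈
react (ν d) with react d
... | _ , t = _ , ν t
react (parˡ d) with react d
... | _ , t = _ , parˡ t
react (parʳ d) with react d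
... | _ , t = _ , parʳ t
react (comˡ d e) = proj₁ (communicate d e)
react (comʳ d e) = proj₂ (communicate e d)
react (rep d) with react d
... | _ , t = _ , rep (parˡ t)
react (repcom d e) with proj₁ (communicate d (rep e))
... | _ , t = _ , rep t

-- Separate choice

mutual

  separate-rename : (f : Ref m → Ref n) → ∀ {P} → Separate P → Separate (rename f P)
  separate-rename f (sumᴵ bs) = sumᴵ (separate-renameᴵ f bs)
  separate-rename f (sumᴼ bs) = sumᴼ (separate-renameᴼ f bs)
  separate-rename f (ν s)     = ν (separate-rename (lift f) s)
  separate-rename f (s ∣ r)   = separate-rename f s ∣ separate-rename f r
  separate-rename f (! s)     = ! separate-rename f s

  separate-renameᴵ : (f : Ref m → Ref n) → ∀ {bs} →
                     All Branchᴵ bs → All Branchᴵ (renameˢ f bs)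
  separate-renameᴵ f []              = []
  separate-renameᴵ f (input s ∷ bs)  = input (separate-rename (lift f) s) ∷ separate-renameᴵ f bs
  separate-renameᴵ f (silent s ∷ bs) = silent (separate-rename f s) ∷ separate-renameᴵ f bs

  separate-renameᴼ : (f : Ref m → Ref n) → ∀ {bs} →
                     All Branchᴼ bs → All Branchᴼ (renameˢ f bs)
  separate-renameᴼ f []              = []
  separate-renameᴼ f (output s ∷ bs) = output (separate-rename f s) ∷ separate-renameᴼ f bs
  separate-renameᴼ f (silent s ∷ bs) = silent (separate-rename f s) ∷ separate-renameᴼ f bs

separate-weaken⊕ : ∀ d {P : Proc n} → Separate P → Separate (weaken⊕ d P)
separate-weaken⊕ false s = s
separate-weaken⊕ true  s = separate-rename shift s

separate-exchange : ∀ d {P : Proc (d ⊕ suc n)} → Separate P → Separate (exchange d P)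
separate-exchange false s = s
separate-exchange true  s = separate-rename swapʳ s

separate-→ : ∀ {a : Act n d} {P P′} → P —⟨ a ⟩→ P′ → Separate P → Separate P′
separate-→ (input b∈) (sumᴵ bs) with All.lookup bs b∈
... | input s = s
separate-→ (input b∈) (sumᴼ bs) with All.lookup bs b∈
... | ()
separate-→ (output b∈) (sumᴵ bs) with All.lookup bs b∈
... | ()
separate-→ (output b∈) (sumᴼ bs) with All.lookup bs b∈
... | output s = s
separate-→ (silent b∈) (sumᴵ bs) with All.lookup bs b∈
... | silent s = s
separate-→ (silent b∈) (sumᴼ bs) with All.lookup bs b∈
... | silent s = s
separate-→ (opening t) (ν s)        = separate-→ t s
separate-→ (ν {d = d} t) (ν s)      = ν (separate-exchange d (separate-→ t s))
separate-→ (parˡ {d = d} t) (s ∣ r) = separate-→ t s ∣ separate-weaken⊕ d r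
separate-→ (parʳ {d = d} t) (s ∣ r) = separate-weaken⊕ d s ∣ separate-→ t r
separate-→ (comˡ t u) (s ∣ r)       = separate-rename _ (separate-→ t s) ∣ separate-→ u r
separate-→ (comʳ t u) (s ∣ r)       = separate-→ t s ∣ separate-rename _ (separate-→ u r)
separate-→ (closeˡ t u) (s ∣ r)     = ν (separate-→ t s ∣ separate-→ u r)
separate-→ (closeʳ t u) (s ∣ r)     = ν (separate-→ t s ∣ separate-→ u r)
separate-→ (rep t) (! s)            = separate-→ t (s ∣ (! s))

-- The output and the input can be performed in either order with the same outcome. If both bind,
-- the two orders introduce the two indices in opposite order, which `swapʳ` reconciles.
data Diamond {n : ℕ} (P : Proc n) (x z : Ref n) : Set where
  free  : ∀ {y P₁ P₂ P₃} →
          P —⟨ output x y ⟩→ P₁ → P₁ —⟨ input z ⟩→ P₃ →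
          P —⟨ input z ⟩→ P₂ → P₂ —⟨ output (shift x) (shift y) ⟩→ P₃ → Diamond P x z
  bound : ∀ {P₁ P₂ P₃} →
          P —⟨ outputν x ⟩→ P₁ → P₁ —⟨ input (shift z) ⟩→ P₃ →
          P —⟨ input z ⟩→ P₂ → P₂ —⟨ outputν (shift x) ⟩→ rename swapʳ P₃ → Diamond P x z

swapʳ-shift : swapʳ ∘ shift ≗ lift (shift {n})
swapʳ-shift (free _)        = refl
swapʳ-shift (bound zero)    = refl
swapʳ-shift (bound (suc _)) = refl

swapʳ-lift-shift : swapʳ ∘ lift (shift {n}) ≗ shift
swapʳ-lift-shift (free _)        = refl
swapʳ-lift-shift (bound zero)    = refl
swapʳ-lift-shift (bound (suc _)) = refl

rename-swap-weaken² : (P : Proc n) → rename swapʳ (weaken (weaken P)) ≡ weaken (weaken P)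
rename-swap-weaken² P = trans (cong (rename swapʳ) (rename-∘ (λ _ → refl) P))
                          (trans (rename-∘ swapʳ-shift² P) (sym (rename-∘ (λ _ → refl) P)))

swapʳ-involutive : swapʳ ∘ swapʳ {n} ≗ id
swapʳ-involutive (free _)              = refl
swapʳ-involutive (bound zero)          = refl
swapʳ-involutive (bound (suc zero))    = refl
swapʳ-involutive (bound (suc (suc _))) = refl

-- The braid relation between adjacent transpositions, for the moment when an extruded, a received
-- and a restricted name change places in `diamond-ν`.
swapʳ-braid : swapʳ ∘ lift swapʳ ∘ swapʳ {suc n} ≗ lift swapʳ ∘ swapʳ ∘ lift swapʳ
swapʳ-braid (free _)                    = refl
swapʳ-braid (bound zero)                = refl
swapʳ-braid (bound (suc zero))          = refl
swapʳ-braid (bound (suc (suc zero)))    = refl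
swapʳ-braid (bound (suc (suc (suc _)))) = refl

diamond-independentˡ : ∀ {P R : Proc n} {x z} → P ↓ sends x → R ↓ receives z → Diamond (P ∣ R) x z
diamond-independentˡ d e with emit d | receive e
... | emission output t  | _ , u =
  free (parˡ t) (parʳ u) (parʳ u) (parˡ (rename-→ shift t))
... | emission {target = P′} outputν t | R′ , u =
  bound (parˡ t) (parʳ (rename-→ shift u)) (parʳ u)
        (to-target (cong₂ _∣_ (sym (rename-∘ swapʳ-shift P′)) (sym (rename-∘ swapʳ-lift-shift R′)))
                   (parˡ (rename-→ shift t)))

diamond-independentʳ : ∀ {P R : Proc n} {x z} → P ↓ receives z → R ↓ sends x → Diamond (P ∣ R) x z
diamond-independentʳ d e with receive d | emit e
... | _ , u  | emission output t =
  free (parʳ t) (parˡ u) (parˡ u) (parʳ (rename-→ shift t))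
... | P′ , u | emission {target = R′} outputν t =
  bound (parʳ t) (parˡ (rename-→ shift u)) (parˡ u)
        (to-target (cong₂ _∣_ (sym (rename-∘ swapʳ-lift-shift P′)) (sym (rename-∘ swapʳ-shift R′)))
                   (parʳ (rename-→ shift t)))

diamond-parˡ : ∀ {P R : Proc n} {x z} → Diamond P x z → Diamond (P ∣ R) x z
diamond-parˡ (free t t′ u u′) = free (parˡ t) (parˡ t′) (parˡ u) (parˡ u′)
diamond-parˡ {R = R} (bound t t′ u u′) = bound (parˡ t) (parˡ t′) (parˡ u)
  (to-target (cong (_ ∣_) (sym (rename-swap-weaken² R))) (parˡ u′))

diamond-parʳ : ∀ {P R : Proc n} {x z} → Diamond R x z → Diamond (P ∣ R) x z
diamond-parʳ (free t t′ u u′) = free (parʳ t) (parʳ t′) (parʳ u) (parʳ u′)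
diamond-parʳ {P = P} (bound t t′ u u′) = bound (parʳ t) (parʳ t′) (parʳ u)
  (to-target (cong (_∣ _) (sym (rename-swap-weaken² P))) (parʳ u′))

diamond-ν : ∀ {P : Proc (suc n)} {x z} → Diamond P (shift x) (shift z) → Diamond (ν P) x z
diamond-ν {x = x} (free {y = free y} t t′ u u′) =
  free (ν {a = output _ (free y)} t) (ν t′) (ν u)
       (ν {a = output _ (free y)}
          (by-action (cong (λ z → output z (free y)) (swapʳ-shift² x)) (rename-→ swapʳ u′)))
-- The object is the restricted name: a diamond with free output below the restriction becomes one
-- with bound output above it.
diamond-ν {x = x} (free {y = bound zero} t t′ u u′) =
  bound (opening t) t′ (ν u)
        (opening (by-action (cong (λ z → output z (bound zero)) (swapʳ-shift² x))
                            (rename-→ swapʳ u′)))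
diamond-ν {x = x} (free {y = bound (suc i)} t t′ u u′) =
  free (ν {a = output _ (bound i)} t) (ν t′) (ν u)
       (ν {a = output _ (bound (suc i))}
          (by-action (cong (λ z → output z (bound (suc (suc i)))) (swapʳ-shift² x))
                     (rename-→ swapʳ u′)))
diamond-ν {x = x} {z} (bound {P₃ = P₃} t t′ u u′) =
  bound (ν t) (ν (by-action (cong input (swapʳ-shift² z)) (rename-→ swapʳ t′))) (ν u)
        (to-target (cong ν braided)
                   (ν (by-action (cong outputν (swapʳ-shift² x)) (rename-→ swapʳ u′))))
  where
  braided : rename swapʳ (rename (lift swapʳ) (rename swapʳ P₃)) ≡
            rename (lift swapʳ) (rename swapʳ (rename (lift swapʳ) P₃))
  braided = trans (cong (rename swapʳ) (rename-∘ (λ _ → refl) P₃))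
              (trans (rename-square swapʳ-braid P₃)
                     (cong (rename (lift swapʳ)) (sym (rename-∘ (λ _ → refl) P₃))))

diamond-rep : ∀ {P : Proc n} {x z} → Diamond (P ∣ ! P) x z → Diamond (! P) x z
diamond-rep (free t t′ u u′)  = free (rep t) t′ (rep u) u′
diamond-rep (bound t t′ u u′) = bound (rep t) t′ (rep u) u′

-- In a separate-choice process the two prefixes belong to different sums.
diamond : ∀ {P : Proc n} {x z} → Separate P → P ↓ sends x → P ↓ receives z → Diamond P x z
diamond (sumᴵ bs) (sum {b = output _ _ _} b∈ refl) e with All.lookup bs b∈
... | ()
diamond (sumᴼ bs) d (sum {b = input _ _} b∈ refl) with All.lookup bs b∈
... | ()
diamond (ν s)   (ν d)    (ν e)    = diamond-ν (diamond s d e)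
diamond (s ∣ r) (parˡ d) (parˡ e) = diamond-parˡ (diamond s d e)
diamond (s ∣ r) (parˡ d) (parʳ e) = diamond-independentˡ d e
diamond (s ∣ r) (parʳ d) (parˡ e) = diamond-independentʳ e d
diamond (s ∣ r) (parʳ d) (parʳ e) = diamond-parʳ (diamond r d e)
-- The output is taken from an unfolded copy and the input from the replication that remains, so
-- they are independent even if one sum of `P` were to be used twice.
diamond (! s)   (rep d)  (rep e)  = diamond-rep (diamond-independentˡ d (rep e))

-- Maximal computations

name : Env 0
name (free x) = x

name-⋆ : ∀ P → name ⋆ P ≡ P
name-⋆ = rename-id (λ { (free _) → refl ; (bound ()) })

sound₀ : ∀ {a : Act 0 d} {P P′} → P —⟨ a ⟩→ P′ → Realises name a P P′
sound₀ {a = a} {P} {P′} t = subst (λ R → Realises name a R P′) (name-⋆ P) (sound t name)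

sound-τ : ∀ {P P′} → P —⟨ τ ⟩→ P′ → P —[ τ ]→ P′
sound-τ {P′ = P′} t = retarget (name-⋆ P′) (sound₀ t)

Final : Process → Set
Final P = ¬ ∃ λ Q → P ⇒ Q

final : ∀ {P} → ¬ P ↓ internal → ¬ P ↓ receives (free out) → ¬ P ↓ sends (free out) → Final P
final ¬i ¬r ¬s (_ , _         , inj₁ refl , t) = ¬i (transition⇒↓ t)
final ¬i ¬r ¬s (_ , recv _ _  , inj₂ refl , t) = ¬r (transition⇒↓ t)
final ¬i ¬r ¬s (_ , send _ _  , inj₂ refl , t) = ¬s (transition⇒↓ t)
final ¬i ¬r ¬s (_ , sendν _ _ , inj₂ refl , t) = ¬s (transition⇒↓ t)

step? : ∀ P → (∃ λ Q → P ⇒ Q) ⊎ Final P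
step? P with P ↓? internal | P ↓? receives (free out) | P ↓? sends (free out)
... | yes e | _     | _     = inj₁ (_ , τ , inj₁ refl , sound₀ (proj₂ (react e)))
-- Any received name would do; `out` is at hand.
... | no _  | yes e | _     = inj₁ (_ , _ , inj₂ refl , sound₀ (proj₂ (receive e)) out)
... | no _  | no _  | yes e with emit e
... | emission (output {free _}) t = inj₁ (_ , _ , inj₂ refl , sound₀ t)
... | emission outputν t with fresh (fn P)
... | k , k∉ = inj₁ (_ , _ , inj₂ refl , sound₀ t k k∉)
step? P | no ¬i | no ¬r | no ¬s = inj₂ (final ¬i ¬r ¬s)

module _ {S : Set} {_↝_ : Rel S 0ℓ} {Stuck : S → Set}
         (next : ∀ s → (∃ λ s′ → s ↝ s′) ⊎ Stuck s) where

  -- Every visited state is kept with a run that reaches it, so `¬halt` refutes the stuck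
  -- alternative of `next`. Only single steps are decided, never whether the system halts.
  unstuck⇒infinite : ∀ s → ¬ (∃ λ s′ → Star _↝_ s s′ × Stuck s′) →
                     Σ[ f ∈ (ℕ → S) ] f 0 ≡ s × (∀ n → f n ↝ f (suc n))
  unstuck⇒infinite s ¬halt = proj₁ ∘ trace , refl , λ n → proj₂ (extend (trace n))
    where
    Reached : Set
    Reached = ∃ λ s′ → Star _↝_ s s′

    extend : (r : Reached) → Σ[ r′ ∈ Reached ] proj₁ r ↝ proj₁ r′
    extend (s′ , run) with next s′
    ... | inj₁ (s″ , step) = (s″ , run ◅◅ (step ◅ ε)) , step
    ... | inj₂ stuck       = ⊥-elim (¬halt (s′ , run , stuck))

    trace : ℕ → Reached
    trace zero    = s , ε
    trace (suc n) = proj₁ (extend (trace n))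

-- Doubly negated, because whether some run of `P` halts is not decided. The final goal is
-- absurdity, where the double negation can be discharged.
some-maximal : ∀ P → ¬ ¬ Σ (Computation P) Maximal
some-maximal P ¬max with unstuck⇒infinite step? P (λ (_ , run , stuck) → ¬max (finite run , stuck))
... | f , f₀ , steps = ¬max (infinite f f₀ steps , tt)

prepend : ∀ {P Q} → P ⇒ Q → Computation Q → Computation P
prepend s (finite run) = finite (s ◅ run)
prepend {P} s (infinite f refl steps) = infinite f′ refl steps′
  where
  f′ : ℕ → Process
  f′ zero    = P
  f′ (suc n) = f n
  steps′ : ∀ n → f′ n ⇒ f′ (suc n)
  steps′ zero    = s
  steps′ (suc n) = steps n

module _ {P Q} (s : P ⇒ Q) where

  prepend-maximal : ∀ (C : Computation Q) → Maximal C → Maximal (prepend s C)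
  prepend-maximal (finite _)           max = max
  prepend-maximal (infinite _ refl _)  max = tt

  prepend-here : ∀ (C : Computation Q) → Performs (prepend s C) (proj₁ s)
  prepend-here (finite _)          = here refl
  prepend-here (infinite _ refl _) = zero , refl

  prepend-there : ∀ (C : Computation Q) {μ} → Performs C μ → Performs (prepend s C) μ
  prepend-there (finite _)          p       = there p
  prepend-there (infinite _ refl _) (n , e) = suc n , e

prepend* : ∀ {P Q} → Star _⇒_ P Q → ∀ C → Maximal C →
           Σ[ D ∈ Computation P ] Maximal D × (∀ {μ} → Performs C μ → Performs D μ)
prepend* ε       C max = C , max , id
prepend* (s ◅ r) C max with prepend* r C max
... | D , max′ , keeps = prepend s D , prepend-maximal s D max′ , prepend-there s D ∘ keeps

extend-maximal : ∀ {P Q} (run : Star _⇒_ P Q) →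
                 ¬ ¬ (Σ[ C ∈ Computation P ] Maximal C × (∀ {μ} → μ ∈ actions run → Performs C μ))
extend-maximal {Q = Q} run ¬C =
  some-maximal Q (λ (D , max) → let C , max′ , sees = along run D max in ¬C (C , max′ , sees))
  where
  along : ∀ {P Q} (run : Star _⇒_ P Q) (D : Computation Q) → Maximal D →
          Σ[ C ∈ Computation P ] Maximal C × (∀ {μ} → μ ∈ actions run → Performs C μ)
  along ε       D max = D , max , λ ()
  along (s ◅ r) D max with along r D max
  ... | C , max′ , sees = prepend s C , prepend-maximal s C max′ ,
        λ { (here refl) → prepend-here s C ; (there μ∈) → prepend-there s C (sees μ∈) }

silently : ∀ {P Q} → Star _—[ τ ]→_ P Q → Star _⇒_ P Q
silently ε       = ε
silently (t ◅ r) = (τ , inj₁ refl , t) ◅ silently r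

silently-τ : ∀ {P Q} (r : Star _—[ τ ]→_ P Q) {μ} → μ ∈ actions (silently r) → μ ≡ τ
silently-τ (t ◅ r) (here refl) = refl
silently-τ (t ◅ r) (there μ∈)  = silently-τ r μ∈

-- Symmetric configurations

close : ∀ n → Proc n → Process
close zero    P = P
close (suc n) P = close n (ν P)

close-τ : ∀ n {P P′} → P —⟨ τ ⟩→ P′ → close n P —⟨ τ ⟩→ close n P′
close-τ zero    t = t
close-τ (suc n) t = close-τ n (ν t)

close-output : ∀ n {P P′ x y} → P —⟨ output (free x) (free y) ⟩→ P′ →
               close n P —⟨ output (free x) (free y) ⟩→ close n P′
close-output zero    t = t
close-output (suc n) t = close-output n (ν {a = output (free _) (free _)} t)

close-outputν : ∀ n {P P′ x} → P —⟨ outputν (free x) ⟩→ P′ →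
                ∃ λ R → close n P —⟨ outputν (free x) ⟩→ R
close-outputν zero    t = _ , t
close-outputν (suc n) t = close-outputν n (ν {a = outputν (free _)} t)

-- The restriction that binds the object extrudes it; those inside and outside of it let the action
-- pass.
close-opening : ∀ n {P P′ x i} → P —⟨ output (free x) (bound i) ⟩→ P′ →
                ∃ λ R → close n P —⟨ outputν (free x) ⟩→ R
close-opening (suc n) {i = zero}  t = close-outputν n (opening {x = free _} t)
close-opening (suc n) {i = suc i} t = close-opening n (ν {a = output (free _) (bound i)} t)

close-↓⁻ : ∀ n {P} o → close n P ↓ o → P ↓ mapᵒ (free ∘ name) o
close-↓⁻ zero {P} o d = subst (P ↓_) (sym (mapᵒ-id o)) d
  where
  mapᵒ-id : ∀ o → mapᵒ (free ∘ name) o ≡ o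
  mapᵒ-id (receives (free _)) = refl
  mapᵒ-id (sends (free _))    = refl
  mapᵒ-id internal            = refl
close-↓⁻ (suc n) {P} o d with close-↓⁻ n o d
... | ν e = subst (P ↓_) (mapᵒ-shift o) e
  where
  mapᵒ-shift : ∀ {n} o → mapᵒ (shift {n}) (mapᵒ (free ∘ name) o) ≡ mapᵒ (free ∘ name) o
  mapᵒ-shift (receives _) = refl
  mapᵒ-shift (sends _)    = refl
  mapᵒ-shift internal     = refl

module Symmetric (π : Name → Name) where

  -- The process ν⋯ν (half ∣ mirror half); the mirror acts as π on free names
  -- and permutes the names extruded so far.
  record Config : Set where
    field
      {bindings} : ℕ
      mirror     : Ref bindings → Ref bindings
      on-free    : ∀ x → mirror (free x) ≡ free (π x)
      involutive : mirror ∘ mirror ≗ id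
      half       : Proc bindings
      separate   : Separate half

    body : Proc bindings
    body = half ∣ rename mirror half

    process : Process
    process = close bindings body

    mirror-injective : Injective _≡_ _≡_ mirror
    mirror-injective {x} {y} e = trans (sym (involutive x)) (trans (cong mirror e) (involutive y))

    ↓-mirror : ∀ {o} → rename mirror half ↓ o → half ↓ mapᵒ mirror o
    ↓-mirror d with ↓-rename⁻ mirror-injective half d
    ... | o′ , refl , d′ = subst (half ↓_) (sym (mapᵒ-involutive o′)) d′
      where
      mapᵒ-involutive : ∀ o → mapᵒ mirror (mapᵒ mirror o) ≡ o
      mapᵒ-involutive (receives x) = cong receives (involutive x)
      mapᵒ-involutive (sends x)    = cong sends (involutive x)
      mapᵒ-involutive internal     = refl

  open Config

  TwoSteps : Config → Set
  TwoSteps c = ∃₂ λ R c′ → process c —⟨ τ ⟩→ R × R —⟨ τ ⟩→ process c′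

  mirrored-react : ∀ c → half c ↓ internal → TwoSteps c
  mirrored-react c d with react d
  ... | Q , t = _ , record { on-free = on-free c ; involutive = involutive c
                           ; separate = separate-→ t (separate c) } ,
    close-τ (bindings c) (parˡ t) , close-τ (bindings c) (parʳ (rename-→ (mirror c) t))

  -- The output of the half meets the input of the mirror half. By the diamond, the input of the
  -- half and the output of the mirror half remain available, and their communication is the mirror
  -- image of the first.
  mirrored-communicate : ∀ c {x} → half c ↓ sends x → half c ↓ receives (mirror c x) → TwoSteps c
  mirrored-communicate c {x} d e with diamond (separate c) d e
  -- The mirror half receives `y` and the half receives `mirror c y`. As the mirror is an
  -- involution, the two instances of `P₃` are again mirror images.
  ... | free {y = y} {P₂ = P₂} {P₃} t t′ u u′ =
    _ , record { on-free = on-free c ; involutive = involutive c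
               ; separate = separate-rename (inst (mirror c y))
                              (separate-→ t′ (separate-→ t (separate c))) } ,
    close-τ (bindings c) (comʳ t (by-action (cong input (involutive c x)) (rename-→ σ u))) ,
    close-τ (bindings c) (to-target (cong (P₃ ⟨ mirror c y ⟩ ∣_) target)
      (comˡ t′ (by-action (cong₂ output (unlifted x) (unlifted y))
                          (rename-→ (inst y) (rename-→ (lift σ) u′)))))
    where
    σ = mirror c
    unlifted : ∀ z → inst y (lift σ (shift z)) ≡ σ z
    unlifted z = trans (cong (inst y) (lift-shift σ z)) (inst-shift y (σ z))
    target : rename (lift σ) P₃ ⟨ y ⟩ ≡ rename σ (P₃ ⟨ σ y ⟩)
    target = trans (cong (rename (lift σ) P₃ ⟨_⟩) (sym (involutive c y)))
                   (sym (rename-⟨⟩ σ (σ y) P₃))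
  ... | bound {P₂ = P₂} {P₃} t t′ u u′ =
    _ , record { bindings = suc (suc (bindings c))
               -- Each half has extruded one name; the new mirror exchanges these two and acts as
               -- before on the others.
               ; mirror = lift (lift σ) ∘ swapʳ
               ; on-free = λ z → cong (shift ∘ shift) (on-free c z)
               ; involutive = involutive′
               ; separate = separate-→ t′ (separate-→ t (separate c)) } ,
    close-τ (bindings c) (closeʳ t (by-action (cong input (involutive c x)) (rename-→ σ u))) ,
    close-τ (suc (bindings c)) (to-target (cong ν (cong (P₃ ∣_) (rename-∘ (λ _ → refl) P₃)))
      (closeˡ t′ (by-action (cong outputν (lift-shift σ x)) (rename-→ (lift σ) u′))))
    where
    σ = mirror c
    involutive′ : (lift (lift σ) ∘ swapʳ) ∘ (lift (lift σ) ∘ swapʳ) ≗ id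
    involutive′ r =
      trans (cong (lift (lift σ)) (sym (swapʳ-lift σ (swapʳ r))))
        (trans (lift-∘ (lift-∘ (involutive c)) (swapʳ (swapʳ r)))
          (trans (lift-id (lift-id (λ _ → refl)) (swapʳ (swapʳ r))) (swapʳ-involutive r)))

  mirrored-step : ∀ c → body c ↓ internal → TwoSteps c
  mirrored-step c (parˡ d)   = mirrored-react c d
  mirrored-step c (parʳ d)   = mirrored-react c (↓-mirror c d)
  mirrored-step c (comʳ d e) = mirrored-communicate c d (↓-mirror c e)
  -- The half receives on `x`, so it sends on `mirror c x`, whose mirror image is `x`: the mirrored
  -- communication is the one of the lemma.
  mirrored-step c (comˡ {x = x} d e) =
    mirrored-communicate c (↓-mirror c e)
      (subst (λ z → half c ↓ receives z) (sym (involutive c x)) d)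

  -- Symmetry is restored after two internal steps. The process in between is kept together with the
  -- second step, so that the sequence of nodes advances by single transitions.
  data Node : Set where
    at  : Config → Node
    mid : ∀ R c → R —⟨ τ ⟩→ process c → Node

  process′ : Node → Process
  process′ (at c)      = process c
  process′ (mid R _ _) = R

  Stuck : Node → Set
  Stuck (at c)      = ¬ process c ↓ internal
  Stuck (mid _ _ _) = ⊥

  next : ∀ s → (∃ λ s′ → process′ s —[ τ ]→ process′ s′) ⊎ Stuck s
  next (mid R c t) = inj₁ (at c , sound-τ t)
  next (at c) with process c ↓? internal
  ... | no ¬d = inj₂ ¬d
  ... | yes d with mirrored-step c (close-↓⁻ (bindings c) internal d)
  ... | R , c′ , t , u = inj₁ (mid R c′ u , sound-τ t)

  -- What a maximal computation that keeps the symmetry can show.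
  data Unfair {P} (C : Computation P) : Set where
    nothing-seen : (∀ μ → ¬ Observable C μ) → Unfair C
    other-seen   : ∀ {μ} → Observable C μ → (∀ x → μ ≢ send out x) → Unfair C
    mirror-seen  : ∀ {x} → Observable C (send out x) → Observable C (send out (π x)) → Unfair C

  UnfairMaximal : Process → Set
  UnfairMaximal P = Σ[ C ∈ Computation P ] Maximal C × Unfair C

  module _ {P : Process} (c : Config) (run : Star _⇒_ P (process c)) (π-out : π out ≡ out) where

    see-one : ∀ {μ Q} → process c —[ μ ]→ Q → OnOut μ → (∀ x → μ ≢ send out x) → ¬ ¬ UnfairMaximal P
    see-one {μ} t o ≢send ¬C = extend-maximal ((μ , inj₂ o , t) ◅ ε) λ (C , max , sees) →
      let D , max′ , keeps = prepend* run C max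
      in ¬C (D , max′ , other-seen (keeps (sees (here refl)) , o) ≢send)

    see-out : half c ↓ sends (free out) → ¬ ¬ UnfairMaximal P
    see-out d with emit d
    ... | emission outputν t with fresh (fn (process c))
    ... | k , k∉ = see-one (sound₀ (proj₂ (close-outputν (bindings c) (parˡ t))) k k∉) refl λ _ ()
    see-out d | emission (output {bound i}) t with fresh (fn (process c))
    ... | k , k∉ = see-one (sound₀ (proj₂ (close-opening (bindings c) (parˡ t))) k k∉) refl λ _ ()
    -- The output of one half leaves the other half untouched, so the mirrored output on `out` can
    -- follow at once.
    see-out d | emission (output {free x}) t = λ ¬C →
      extend-maximal ((_ , inj₂ refl , first) ◅ (_ , inj₂ refl , second) ◅ ε) λ (C , max , sees) →
        let D , max′ , keeps = prepend* run C max
        in ¬C (D , max′ , mirror-seen (keeps (sees (here refl)) , refl)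
                                      (keeps (sees (there (here refl))) , refl))
      where
      mirrored : rename (mirror c) (half c) —⟨ output (free out) (free (π x)) ⟩→ _
      mirrored = by-action (cong₂ output (trans (on-free c out) (cong free π-out)) (on-free c x))
                           (rename-→ (mirror c) t)
      first = sound₀ (close-output (bindings c) (parˡ {Q = rename (mirror c) (half c)} t))
      second = rewrite-→ (sym (name-⋆ _)) refl
                 (sound₀ (close-output (bindings c) (parʳ mirrored)))

    out-seen : body c ↓ sends (free out) → ¬ ¬ UnfairMaximal P
    out-seen (parˡ d) = see-out d
    out-seen (parʳ d) = see-out (subst (λ z → half c ↓ sends z)
                                  (trans (on-free c out) (cong free π-out)) (↓-mirror c d))

  halted : ∀ {P} → π out ≡ out → ∀ c → Star _—[ τ ]→_ P (process c) → ¬ process c ↓ internal →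
           ¬ ¬ UnfairMaximal P
  halted π-out c run ¬i with process c ↓? receives (free out) | process c ↓? sends (free out)
  ... | yes d | _     = see-one c (silently run) π-out (sound₀ (proj₂ (receive d)) out) refl λ _ ()
  ... | no _  | yes d = out-seen c (silently run) π-out (close-↓⁻ (bindings c) _ d)
  ... | no ¬r | no ¬s = λ ¬C → ¬C (finite (silently run) , final ¬i ¬r ¬s , nothing-seen unseen)
    where
    unseen : ∀ μ → ¬ (μ ∈ actions (silently run) × OnOut μ)
    unseen μ (μ∈ , o) with silently-τ run μ∈
    unseen μ (μ∈ , ()) | refl

  -- If no unfair maximal computation existed, `halted` would exclude every reachable stuck
  -- configuration; the symmetric rounds would then go on forever in silence, which is itself unfair
  -- and maximal.
  symmetric-unfair : π out ≡ out → ∀ c → ¬ ¬ UnfairMaximal (process c)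
  symmetric-unfair π-out c ¬C with unstuck⇒infinite next (at c) ¬halts
    where
    ¬halts : ¬ ∃ λ s → Star _ (at c) s × Stuck s
    ¬halts (at c′ , run , ¬i) =
      halted π-out c′ (Star.gmap process′ id run) ¬i ¬C
  ... | f , f₀ , steps =
    ¬C (infinite (process′ ∘ f) (cong process′ f₀) (λ n → τ , inj₁ refl , steps n) , tt ,
        nothing-seen λ { μ ((n , refl) , ()) })

-- Finite processes without restriction: structural congruence is equality

mutual

  data Plain {n : ℕ} : Proc n → Set where
    sum : ∀ {bs} → All Plainᵇ bs → Plain (sum bs)
    _∣_ : ∀ {P Q} → Plain P → Plain Q → Plain (P ∣ Q)

  data Plainᵇ {n : ℕ} : Branch n → Set where
    input  : ∀ {x P} → Plain P → Plainᵇ (input x P)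
    output : ∀ {x y P} → Plain P → Plainᵇ (output x y P)
    silent : ∀ {P} → Plain P → Plainᵇ (silent P)

mutual

  plain-rename : (f : Ref m → Ref n) → ∀ {P} → Plain P → Plain (rename f P)
  plain-rename f (sum bs) = sum (plain-renameˢ f bs)
  plain-rename f (p ∣ q)  = plain-rename f p ∣ plain-rename f q

  plain-renameˢ : (f : Ref m → Ref n) → ∀ {bs} → All Plainᵇ bs → All Plainᵇ (renameˢ f bs)
  plain-renameˢ f []              = []
  plain-renameˢ f (input p ∷ bs)  = input (plain-rename (lift f) p) ∷ plain-renameˢ f bs
  plain-renameˢ f (output p ∷ bs) = output (plain-rename f p) ∷ plain-renameˢ f bs
  plain-renameˢ f (silent p ∷ bs) = silent (plain-rename f p) ∷ plain-renameˢ f bs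

mutual

  -- Both implications are proved together, since symmetry exchanges the two sides. Neither side of
  -- `extrude` is plain.
  plain-≅ : ∀ {P Q : Proc n} → P ≅ Q → (Plain P → P ≡ Q) × (Plain Q → P ≡ Q)
  plain-≅ extrude         = (λ { (() ∣ _) }) , λ ()
  plain-≅ ≅-refl          = (λ _ → refl) , (λ _ → refl)
  plain-≅ (≅-sym e)       = sym ∘ proj₂ (plain-≅ e) , sym ∘ proj₁ (plain-≅ e)
  plain-≅ (≅-trans e e′)  =
    (λ p → let P≡Q = proj₁ (plain-≅ e) p in
           trans P≡Q (proj₁ (plain-≅ e′) (subst Plain P≡Q p))) ,
    (λ r → let Q≡R = proj₂ (plain-≅ e′) r in
           trans (proj₂ (plain-≅ e) (subst Plain (sym Q≡R) r)) Q≡R)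
  plain-≅ (≅-sum es)      = (λ { (sum bs) → cong sum (proj₁ (plain-≅ˢ es) bs) }) ,
                            (λ { (sum cs) → cong sum (proj₂ (plain-≅ˢ es) cs) })
  plain-≅ (≅-ν e)         = (λ ()) , (λ ())
  plain-≅ (≅-∣ e e′)      =
    (λ { (p ∣ q) → cong₂ _∣_ (proj₁ (plain-≅ e) p) (proj₁ (plain-≅ e′) q) }) ,
    (λ { (p ∣ q) → cong₂ _∣_ (proj₂ (plain-≅ e) p) (proj₂ (plain-≅ e′) q) })
  plain-≅ (≅-! e)         = (λ ()) , (λ ())

  plain-≅ˢ : ∀ {bs cs : List (Branch n)} → Pointwise _≅ᵇ_ bs cs →
             (All Plainᵇ bs → bs ≡ cs) × (All Plainᵇ cs → bs ≡ cs)
  plain-≅ˢ []       = (λ _ → refl) , (λ _ → refl)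
  plain-≅ˢ (e ∷ es) =
    (λ { (b ∷ bs) → cong₂ _∷_ (proj₁ (plain-≅ᵇ e) b) (proj₁ (plain-≅ˢ es) bs) }) ,
    (λ { (c ∷ cs) → cong₂ _∷_ (proj₂ (plain-≅ᵇ e) c) (proj₂ (plain-≅ˢ es) cs) })

  plain-≅ᵇ : ∀ {b c : Branch n} → b ≅ᵇ c → (Plainᵇ b → b ≡ c) × (Plainᵇ c → b ≡ c)
  plain-≅ᵇ (input e)  = (λ { (input p)  → cong (input _) (proj₁ (plain-≅ e) p) }) ,
                        (λ { (input q)  → cong (input _) (proj₂ (plain-≅ e) q) })
  plain-≅ᵇ (output e) = (λ { (output p) → cong (output _ _) (proj₁ (plain-≅ e) p) }) ,
                        (λ { (output q) → cong (output _ _) (proj₂ (plain-≅ e) q) })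
  plain-≅ᵇ (silent e) = (λ { (silent p) → cong silent (proj₁ (plain-≅ e) p) }) ,
                        (λ { (silent q) → cong silent (proj₂ (plain-≅ e) q) })

-- Transitions without structural congruence, so that all steps of a concrete process are found by
-- case analysis.
data PlainStep : Process → Action → Process → Set where
  i-sum : ∀ {bs x P} y → input (free x) P ∈ bs → PlainStep (sum bs) (recv x y) (P [ y ])
  o-sum : ∀ {bs x y P} → output (free x) (free y) P ∈ bs → PlainStep (sum bs) (send x y) P
  τ-sum : ∀ {bs P} → silent P ∈ bs → PlainStep (sum bs) τ P
  parˡ  : ∀ {P P′ Q μ} → PlainStep P μ P′ → PlainStep (P ∣ Q) μ (P′ ∣ Q)
  parʳ  : ∀ {P Q Q′ μ} → PlainStep Q μ Q′ → PlainStep (P ∣ Q) μ (P ∣ Q′)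
  comˡ  : ∀ {P P′ Q Q′ x y} → PlainStep P (recv x y) P′ → PlainStep Q (send x y) Q′ →
          PlainStep (P ∣ Q) τ (P′ ∣ Q′)
  comʳ  : ∀ {P P′ Q Q′ x y} → PlainStep P (send x y) P′ → PlainStep Q (recv x y) Q′ →
          PlainStep (P ∣ Q) τ (P′ ∣ Q′)

plain-step-free : ∀ {P Q x k} → ¬ PlainStep P (sendν x k) Q
plain-step-free (parˡ t) = plain-step-free t
plain-step-free (parʳ t) = plain-step-free t

plain-step : ∀ {P Q μ} → Plain P → P —[ μ ]→ Q → PlainStep P μ Q × Plain Q
plain-step (sum bs) (i-sum y b∈) with All.lookup bs b∈
... | input p = i-sum y b∈ , plain-rename (instʳ y) p
plain-step (sum bs) (o-sum b∈) with All.lookup bs b∈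
... | output p = o-sum b∈ , p
plain-step (sum bs) (τ-sum b∈) with All.lookup bs b∈
... | silent p = τ-sum b∈ , p
plain-step (p ∣ q) (parˡ t _) with plain-step p t
... | t′ , p′ = parˡ t′ , (p′ ∣ q)
plain-step (p ∣ q) (parʳ t _) with plain-step q t
... | t′ , q′ = parʳ t′ , (p ∣ q′)
plain-step (p ∣ q) (comˡ t u) with plain-step p t | plain-step q u
... | t′ , p′ | u′ , q′ = comˡ t′ u′ , (p′ ∣ q′)
plain-step (p ∣ q) (comʳ t u) with plain-step p t | plain-step q u
... | t′ , p′ | u′ , q′ = comʳ t′ u′ , (p′ ∣ q′)
plain-step (p ∣ q) (closeˡ t u _) = ⊥-elim (plain-step-free (proj₁ (plain-step q u)))
plain-step (p ∣ q) (closeʳ t u _) = ⊥-elim (plain-step-free (proj₁ (plain-step p t)))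
plain-step p (struct e t e′) with proj₁ (plain-≅ e) p
... | refl with plain-step p t
... | t′ , q with proj₁ (plain-≅ e′) q
... | refl = t′ , q

-- Electing a leader with mixed choice

idle : Proc n
idle = sum []

announce : ℕ → Proc n
announce i = sum (output (free out) (free (ident i)) idle ∷ [])

candidate : ℕ → Process
candidate i = sum (input (free (chan 0)) (announce i) ∷
                   output (free (chan 0)) (free (chan 0)) idle ∷ [])

network : Process
network = candidate 0 ∣ candidate 1

plain-idle : Plain {n} idle
plain-idle = sum []

plain-announce : ∀ i → Plain {n} (announce i)
plain-announce i = sum (output plain-idle ∷ [])

plain-candidate : ∀ i → Plain (candidate i)
plain-candidate i = sum (input (plain-announce i) ∷ output plain-idle ∷ [])

Announces : Name → Process → Set
Announces x P = (∃ λ Q → P ⇒ Q) × (∀ {Q} (s : P ⇒ Q) → proj₁ s ≡ send out x × Final Q)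

Decides : ∀ {P} → Name → Computation P → Set
Decides x C = Observable C (send out x) × (∀ μ → Observable C μ → μ ≡ send out x)

announces-decides : ∀ {P x} → Announces x P → ∀ (C : Computation P) → Maximal C → Decides x C
announces-decides (can , _) (finite ε) max = ⊥-elim (max can)
announces-decides (_ , only) (finite (s ◅ ε)) max with only s
... | e , _ = (here (sym e) , refl) , λ { μ (here refl , _) → e }
announces-decides (_ , only) (finite (s ◅ s′ ◅ _)) max = ⊥-elim (proj₂ (only s) (_ , s′))
announces-decides (_ , only) (infinite f refl steps) max =
  ⊥-elim (proj₂ (only (steps 0)) (_ , steps 1))

final-idle : Final (idle ∣ idle)
final-idle (_ , _ , _ , t) with plain-step (plain-idle ∣ plain-idle) t
... | parˡ (i-sum _ ()) , _
... | parˡ (o-sum ()) , _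
... | parˡ (τ-sum ()) , _
... | parʳ (i-sum _ ()) , _
... | parʳ (o-sum ()) , _
... | parʳ (τ-sum ()) , _
... | comˡ (i-sum _ ()) _ , _
... | comʳ (o-sum ()) _ , _

announceˡ : ∀ i → Announces (ident i) (announce i ∣ idle)
announceˡ i = (_ , _ , inj₂ refl , parˡ (o-sum (here refl)) λ ()) , only
  where
  only : ∀ {Q} (s : announce i ∣ idle ⇒ Q) → proj₁ s ≡ send out (ident i) × Final Q
  only (_ , _ , t) with plain-step (plain-announce i ∣ plain-idle) t
  ... | parˡ (o-sum (here refl)) , _ = refl , final-idle
  ... | parˡ (i-sum _ (there ())) , _
  ... | parˡ (τ-sum (there ())) , _
  ... | parʳ (i-sum _ ()) , _
  ... | parʳ (o-sum ()) , _
  ... | parʳ (τ-sum ()) , _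
  ... | comˡ (i-sum _ (there ())) _ , _
  ... | comʳ (o-sum (here refl)) (i-sum _ ()) , _

announceʳ : ∀ i → Announces (ident i) (idle ∣ announce i)
announceʳ i = (_ , _ , inj₂ refl , parʳ (o-sum (here refl)) λ ()) , only
  where
  only : ∀ {Q} (s : idle ∣ announce i ⇒ Q) → proj₁ s ≡ send out (ident i) × Final Q
  only (_ , _ , t) with plain-step (plain-idle ∣ plain-announce i) t
  ... | parʳ (o-sum (here refl)) , _ = refl , final-idle
  ... | parʳ (i-sum _ (there ())) , _
  ... | parʳ (τ-sum (there ())) , _
  ... | parˡ (i-sum _ ()) , _
  ... | parˡ (o-sum ()) , _
  ... | parˡ (τ-sum ()) , _
  ... | comˡ (i-sum _ ()) _ , _
  ... | comʳ (o-sum ()) _ , _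

network-step : ∀ {Q} (s : network ⇒ Q) →
               proj₁ s ≡ τ × (Announces (ident 0) Q ⊎ Announces (ident 1) Q)
network-step (_ , v , t) with v | plain-step (plain-candidate 0 ∣ plain-candidate 1) t
... | _       | comˡ (i-sum _ (here refl)) (o-sum (there (here refl))) , _ = refl , inj₁ (announceˡ 0)
... | _       | comʳ (o-sum (there (here refl))) (i-sum _ (here refl)) , _ = refl , inj₂ (announceʳ 1)
-- A prefix acting alone is visible on `chan 0`, not on `out`, and so is no step of a computation.
... | inj₂ () | parˡ (i-sum _ (here refl)) , _
... | inj₂ () | parˡ (o-sum (there (here refl))) , _
... | inj₂ () | parʳ (i-sum _ (here refl)) , _
... | inj₂ () | parʳ (o-sum (there (here refl))) , _
... | _       | parˡ (i-sum _ (there (there ()))) , _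
... | _       | parˡ (o-sum (there (there ()))) , _
... | _       | parˡ (τ-sum (there (there ()))) , _
... | _       | parʳ (i-sum _ (there (there ()))) , _
... | _       | parʳ (o-sum (there (there ()))) , _
... | _       | parʳ (τ-sum (there (there ()))) , _
... | _       | comˡ (i-sum _ (there (there ()))) _ , _
... | _       | comˡ _ (o-sum (there (there ()))) , _
... | _       | comʳ (o-sum (there (there ()))) _ , _
... | _       | comʳ _ (i-sum _ (there (there ()))) , _

network-decides : ∀ (C : Computation network) → Maximal C →
                  Decides (ident 0) C ⊎ Decides (ident 1) C
network-decides (finite ε) max =
  ⊥-elim (max (_ , τ , inj₁ refl ,
               comˡ (i-sum (chan 0) (here refl)) (o-sum (there (here refl)))))
network-decides (finite (s ◅ run)) max with network-step s
... | e , announces = Sum.map decides decides announces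
  where
  decides : ∀ {x} → Announces x _ → Decides x (finite (s ◅ run))
  decides a with announces-decides a (finite run) max
  ... | (p , o) , only = (there p , o) ,
    λ { μ (here refl , o′) → ⊥-elim (τ-silent e o′) ; μ (there p′ , o′) → only μ (p′ , o′) }
    where
    τ-silent : ∀ {μ} → μ ≡ τ → ¬ OnOut μ
    τ-silent refl ()
-- After the communication and the announcement the process is final, which contradicts a third
-- step.
network-decides (infinite f f₀ steps) max with network-step (subst (_⇒ f 1) f₀ (steps 0))
... | _ , inj₁ (_ , only) = ⊥-elim (proj₂ (only (steps 1)) (_ , steps 2))
... | _ , inj₂ (_ , only) = ⊥-elim (proj₂ (only (steps 1)) (_ , steps 2))

-- Uniform encodings preserving a reasonable semantics

transposeᶠ : Name → Name → Name → Name
transposeᶠ a b x with x ≟ a | x ≟ b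
... | yes _ | _     = b
... | no _  | yes _ = a
... | no _  | no _  = x

transposeᶠ-involutive : ∀ a b → transposeᶠ a b ∘ transposeᶠ a b ≗ id
transposeᶠ-involutive a b x with x ≟ a | x ≟ b
transposeᶠ-involutive a b x | yes refl | _ with b ≟ a | b ≟ b
... | yes b≡a | _ = b≡a
... | no _ | yes _ = refl
... | no _ | no b≢b = ⊥-elim (b≢b refl)
transposeᶠ-involutive a b x | no _ | yes refl with a ≟ a
... | yes _ = refl
... | no a≢a = ⊥-elim (a≢a refl)
transposeᶠ-involutive a b x | no x≢a | no x≢b with x ≟ a | x ≟ b
... | yes x≡a | _ = ⊥-elim (x≢a x≡a)
... | no _ | yes x≡b = ⊥-elim (x≢b x≡b)
... | no _ | no _ = refl

transposeᶠ-left : ∀ a b → transposeᶠ a b a ≡ b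
transposeᶠ-left a b with a ≟ a
... | yes _ = refl
... | no a≢a = ⊥-elim (a≢a refl)

transpose : Name → Name → Permutation
transpose a b = mk↔ₛ′ f f (transposeᶠ-involutive a b) (transposeᶠ-involutive a b)
  where f = transposeᶠ a b

-- An identifier that is not free could only be learnt by an input from outside. A computation
-- receives on `out` alone, and that would be an observable other than the announcement.
fresh-announcement : ∀ {P Q i} (s : P ⇒ Q) → ident i ∉ fn P →
                     (OnOut (proj₁ s) → proj₁ s ≡ send out (ident i)) →
                     proj₁ s ≢ send out (ident i) × ident i ∉ fn Q
fresh-announcement (_ , inj₁ refl , t) i∉ only = (λ ()) , proj₂ (ident-fresh t i∉ λ _ ())
fresh-announcement (_ , inj₂ o , t) i∉ only with only o
... | refl = ⊥-elim (proj₁ (ident-fresh t i∉ λ _ ()) (there (here refl)))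

fresh-undecided : ∀ {P i} → ident i ∉ fn P → (C : Computation P) → ¬ Decides (ident i) C
fresh-undecided {i = i} i∉ (finite run) ((p , _) , only) =
  finite-run run i∉ (λ q o → only _ (q , o)) p
  where
  finite-run : ∀ {P Q} (run : Star _⇒_ P Q) → ident i ∉ fn P →
               (∀ {μ} → μ ∈ actions run → OnOut μ → μ ≡ send out (ident i)) →
               send out (ident i) ∉ actions run
  finite-run (s ◅ run) i∉ only p with fresh-announcement s i∉ (only (here refl)) | p
  ... | s≢ , _   | here e  = s≢ (sym e)
  ... | _  , i∉′ | there q = finite-run run i∉′ (only ∘ there) q
fresh-undecided {i = i} i∉ (infinite f refl steps) (((n , e) , _) , only) =
  proj₁ (fresh-announcement (steps n) (always n) (λ o → only _ ((n , refl) , o))) e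
  where
  always : ∀ n → ident i ∉ fn (f n)
  always zero    = i∉
  always (suc n) = proj₂ (fresh-announcement (steps n) (always n) (λ o → only _ ((n , refl) , o)))

module _ (E : Encoding) (U : Uniform E) where
  open Encoding E
  open Uniform U

  private
    Θ : Permutation → Permutation
    Θ σ = proj₁ (renamed σ)

    encode-· : ∀ σ P → ⟦ σ · P ⟧ ≡ Θ σ · ⟦ P ⟧
    encode-· σ = proj₂ (proj₂ (renamed σ))

    θ : Permutation → Name → Name
    θ σ = Inverse.to (Θ σ)

    θ-ident : ∀ σ i → θ σ (ident i) ≡ Inverse.to σ (ident i)
    θ-ident σ i = sym (proj₁ (proj₂ (renamed σ)) i)

  -- If some encoding ⟦ P ⟧ has the identifier i free, every name x is the
  -- image of i under a transposition ρ, and θ_σ x = θ_σ (θ_ρ i) = θ_{σρ} i,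
  -- where θ_{σρ} i = σ (ρ i) = σ x as i is an identifier.
  uniform-permutation : ∀ {P i} → ident i ∈ fn ⟦ P ⟧ → ∀ σ → θ σ ≗ Inverse.to σ
  uniform-permutation {P} {i} i∈ σ x = begin
    θ σ x                     ≡⟨ cong (θ σ) (transposeᶠ-left (ident i) x) ⟨
    θ σ (to ρ (ident i))      ≡⟨ cong (θ σ) (θ-ident ρ i) ⟨
    θ σ (θ ρ (ident i))       ≡⟨ free-injective (rename-determines ⟦ P ⟧ composed i∈) ⟩
    θ κ (ident i)             ≡⟨ θ-ident κ i ⟩
    to σ (to ρ (ident i))     ≡⟨ cong (to σ) (transposeᶠ-left (ident i) x) ⟩
    to σ x                    ∎
    where
    open ≡-Reasoning
    open Inverse using (to)
    ρ = transpose (ident i) x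
    κ = σ ↔-∘ ρ
    free-injective : ∀ {x y} → free {0} x ≡ free y → x ≡ y
    free-injective refl = refl
    composed : rename (permuteʳ (Θ σ) ∘ permuteʳ (Θ ρ)) ⟦ P ⟧ ≡ Θ κ · ⟦ P ⟧
    composed = begin
      rename (permuteʳ (Θ σ) ∘ permuteʳ (Θ ρ)) ⟦ P ⟧  ≡⟨ rename-∘ (λ _ → refl) ⟦ P ⟧ ⟨
      Θ σ · Θ ρ · ⟦ P ⟧  ≡⟨ cong (Θ σ ·_) (encode-· ρ P) ⟨
      Θ σ · ⟦ ρ · P ⟧    ≡⟨ encode-· σ (ρ · P) ⟨
      ⟦ σ · ρ · P ⟧      ≡⟨ cong ⟦_⟧ (rename-∘ (λ { (free _) → refl ; (bound ()) }) P) ⟩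
      ⟦ κ · P ⟧          ≡⟨ encode-· κ P ⟩
      Θ κ · ⟦ P ⟧        ∎

  module _ {ℓ} {R : Rel Process ℓ} (R-equiv : IsEquivalence R)
           (reasonable : Reasonable R) (preserves : Preserves E R) where

    matched : ∀ P (C : Computation P) → Maximal C →
              ¬ (∀ (D : Computation ⟦ P ⟧) → Maximal D → ¬ SameObservables C D)
    matched P C max ¬same = preserves P (reasonable P ⟦ P ⟧ (C , max , ¬same))

    -- Reasonableness is applied from the encoding to the source; symmetry of `R` makes it meet
    -- preservation, which is stated from the source to the encoding.
    matched⁻¹ : ∀ P (C : Computation ⟦ P ⟧) → Maximal C →
                ¬ (∀ (D : Computation P) → Maximal D → ¬ SameObservables C D)
    matched⁻¹ P C max ¬same =
      preserves P (reasonable ⟦ P ⟧ P (C , max , ¬same) ∘ IsEquivalence.sym R-equiv)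

    -- Supplies the free identifier that `uniform-permutation` asks for: `announce 0 ∣ idle` always
    -- announces 0, which its encoding could not do without having 0 free.
    ident-free : ident 0 ∈ fn ⟦ announce 0 ∣ idle ⟧
    ident-free with Any.any? (ident 0 ≟_) (fn ⟦ announce 0 ∣ idle ⟧)
    ... | yes i∈ = i∈
    ... | no i∉ = ⊥-elim (some-maximal (announce 0 ∣ idle) λ (C , max) →
      matched _ C max λ D _ same →
        fresh-undecided i∉ D (decides-same same (announces-decides (announceˡ 0) C max)))
      where
      open Equivalence
      decides-same : ∀ {P Q x} {C : Computation P} {D : Computation Q} →
                     SameObservables C D → Decides x C → Decides x D
      decides-same same (p , only) = to (same _) p , λ μ → only μ ∘ from (same μ)

    σ : Permutation
    σ = transpose (ident 0) (ident 1)

    open Symmetric (Inverse.to σ)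

    -- A deciding computation shows exactly one announcement. Since `x` is moved by the
    -- transposition, two mirrored announcements cannot both be that one.
    unfair-undecided : ∀ {P Q} {C : Computation P} {D : Computation Q} {x} →
                       Inverse.to σ x ≢ x → SameObservables C D → Unfair C → ¬ Decides x D
    unfair-undecided σx≢x same (nothing-seen none) (p , _) = none _ (Equivalence.from (same _) p)
    unfair-undecided σx≢x same (other-seen p μ≢) (_ , only) =
      μ≢ _ (only _ (Equivalence.to (same _) p))
    unfair-undecided σx≢x same (mirror-seen p q) (_ , only)
      with only _ (Equivalence.to (same _) p) | only _ (Equivalence.to (same _) q)
    ... | refl | e = σx≢x (send-injective e)
      where
      send-injective : ∀ {x y} → send out x ≡ send out y → x ≡ y
      send-injective refl = refl

    encoded : Config
    encoded = record
      { mirror     = permuteʳ σ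
      ; on-free    = λ _ → refl
      ; involutive = λ { (free x) → cong free (transposeᶠ-involutive _ _ x) ; (bound ()) }
      ; separate   = separate (candidate 0)
      }

    encoded-network : ⟦ network ⟧ ≡ Config.process encoded
    encoded-network = trans (parallel (candidate 0) (candidate 1))
      (cong (⟦ candidate 0 ⟧ ∣_)
        -- `σ · candidate 0` computes to `candidate 1`, as `chan 0` and `out` are fixed by the
        -- transposition.
        (trans (encode-· σ (candidate 0))
               (rename-cong (λ { (free x) → cong free (uniform-permutation ident-free σ x) ; (bound ()) })
                            ⟦ candidate 0 ⟧)))

    contradiction : ⊥
    contradiction = subst (λ P → ¬ ¬ UnfairMaximal P) (sym encoded-network)
                          (symmetric-unfair refl encoded) λ (C , max , unfair) →
      matched⁻¹ network C max λ D max′ same →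
        [ unfair-undecided (λ ()) same unfair , unfair-undecided (λ ()) same unfair ]′
        (network-decides D max′)

corollary7p1 : ∀ {ℓ} →
    ¬ (Σ[ E ∈ Encoding ] Uniform E ×
    (Σ[ R ∈ Rel Process ℓ ]
    IsEquivalence R × Reasonable R × Preserves E R))
corollary7p1 (E , U , R , R-equiv , reasonable , preserves) =
  contradiction E U R-equiv reasonable preserves
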